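{- Let $N\ge 1$, $p\ge 1$ and $N^*\ge N$ be integers. Let $\mathcal{I}_{N,p}$ be the set of fixed point free involutions of $\{1,2,\dots,2N\}$ (i.e. permutations consisting solely of two-cycles) whose maximum decreasing subsequence length is less than or equal to $2p$. Then each of the following two sets of random turns vicious walker configurations on the half line lattice $\{l\in\mathbb{Z}: l\ge 1\}$ is in bijection with $\mathcal{I}_{N,p}$: (first class) the set of all walker configurations of $2N$ steps with exactly $p$ walkers, which start on the sites $l=1,2,\dots,p$ and after $2N$ steps have returned to their initial sites; (second class) the set of all walker configurations of $2N$ steps with exactly $N^*$ walkers, which start on the sites $l=1,2,\dots,N^*$ and after $2N$ steps have returned to their initial sites, and for which the right-most walker is, at every time, displaced by no more than $p$ lattice sites from its initial position.
   Context: Random turns vicious walker configurations: a configuration of $m$ walkers with $n$ steps, confined to $l\ge 1$, is a sequence of $n+1$ position vectors $(l_1(t),\dots,l_m(t))\in\mathbb{Z}^m$, $t=0,1,\dots,n$, with $1\le l_1(t)<l_2(t)<\cdots<l_m(t)$ for every $t$, such that at each time step $t-1\to t$ exactly one walker moves, and it moves by exactly one lattice site to the left or to the right (so necessarily onto a vacant site $l \ge 1$), all other walkers staying put. The right-most walker is the one with position $l_m(t)$, and its displacement at time $t$ is $l_m(t)-l_m(0)$. A decreasing subsequence of length $k$ of a permutation $\sigma$ of $\{1,\dots,2N\}$ is a choice of indices $a_1<\cdots<a_k$ with $\sigma(a_1)>\cdots>\sigma(a_k)$. -}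

module Defs where

open import Algebra.Definitions using (Involutive)
open import Data.Fin.Base as Fin using (Fin; inject₁; fromℕ; toℕ)
open import Data.Fin.Permutation using (Permutation′; _⟨$⟩ʳ_)
open import Data.Integer.Base as ℤ using (ℤ; +_; ∣_∣)
open import Data.Nat.Base using (ℕ; suc; _*_; _≤_; NonZero)
open import Data.Product.Base using (∃-syntax; _×_)
open import Data.Sum.Base using (_⊎_)
open import Data.Vec.Functional using (Vector)
import Data.Vec.Functional.Relation.Binary.Pointwise.Properties as Pointwise
open import Function.Base using (_∘_)
open import Level using (0ℓ)
open import Relation.Binary.Bundles using (Setoid)
open import Relation.Binary.Core using (_Preserves_⟶_)
import Relation.Binary.Construct.On as On
open import Relation.Binary.PropositionalEquality
  using (_≡_; _≢_; setoid)

-- Walkers are numbered from 0 by Fin m, from left to right, so that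
-- walker i of a packed initial configuration sits on the site i + 1.

Position : ℕ → Set
Position m = Vector ℤ m

Confined : ∀ {m} → Position m → Set
Confined l = ∀ i → + 1 ℤ.≤ l i

Step : ∀ {m} → Position m → Position m → Set
Step l l′ = ∃[ i ]
  ((l′ i ≡ l i ℤ.+ + 1) ⊎ (l′ i ≡ l i ℤ.- + 1)) ×
  (∀ j → j ≢ i → l′ j ≡ l j)

record Configuration (m n : ℕ) : Set where
  field
    positions : Vector (Position m) (suc n)
    confined  : ∀ t → Confined (positions t)
    ordered   : ∀ t → positions t Preserves Fin._<_ ⟶ ℤ._<_
    steps     : ∀ (t : Fin n) →
                Step (positions (inject₁ t)) (positions (Fin.suc t))

  initial : Position m
  initial = positions Fin.zero

  final : Position m
  final = positions (fromℕ n)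

open Configuration public

StartsPacked : ∀ {m n} → Configuration m n → Set
StartsPacked c = ∀ i → initial c i ≡ + suc (toℕ i)

Returns : ∀ {m n} → Configuration m n → Set
Returns c = ∀ i → final c i ≡ initial c i

rightmost : ∀ {m} → .{{NonZero m}} → Fin m
rightmost {suc m} = fromℕ m

displacement : ∀ {m n} → .{{NonZero m}} →
               Configuration m n → Fin (suc n) → ℤ
displacement c t = positions c t rightmost ℤ.- initial c rightmost

record FirstClass (N p : ℕ) : Set where
  field
    configuration : Configuration p (2 * N)
    startsPacked  : StartsPacked configuration
    returns       : Returns configuration

record SecondClass (N p N* : ℕ) .{{_ : NonZero N*}} : Set where
  field
    configuration : Configuration N* (2 * N)
    startsPacked  : StartsPacked configuration
    returns       : Returns configuration
    bounded       : ∀ t → ∣ displacement configuration t ∣ ≤ p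

record DecreasingSubsequence {n : ℕ} (σ : Permutation′ n) (k : ℕ) : Set where
  field
    indices    : Fin k → Fin n
    increasing : indices Preserves Fin._<_ ⟶ Fin._<_
    decreasing : ((σ ⟨$⟩ʳ_) ∘ indices) Preserves Fin._<_ ⟶ Fin._>_

IsMaxDecreasingLength : ∀ {n} → Permutation′ n → ℕ → Set
IsMaxDecreasingLength σ k =
  DecreasingSubsequence σ k × (∀ j → DecreasingSubsequence σ j → j ≤ k)

-- Fin (2 * N) stands for {1, …, 2N}, each number being shifted down by one.

record BoundedInvolution (N p : ℕ) : Set where
  field
    permutation    : Permutation′ (2 * N)
    involutive     : Involutive _≡_ (permutation ⟨$⟩ʳ_)
    fixedPointFree : ∀ i → permutation ⟨$⟩ʳ i ≢ i
    maxDecreasing  : ∃[ k ] IsMaxDecreasingLength permutation k × k ≤ 2 * p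

-- In the absence of function extensionality, two configurations are equal
-- when all their positions agree, and two permutations when all their values
-- agree; the proofs of the defining conditions are disregarded.

trajectories : (m n : ℕ) → Setoid 0ℓ 0ℓ
trajectories m n = Pointwise.setoid (Pointwise.setoid (setoid ℤ) m) (suc n)

firstClass : (N p : ℕ) → Setoid 0ℓ 0ℓ
firstClass N p = On.setoid (trajectories p (2 * N))
  (positions ∘ FirstClass.configuration {N} {p})

secondClass : (N p N* : ℕ) → .{{NonZero N*}} → Setoid 0ℓ 0ℓ
secondClass N p N* = On.setoid (trajectories N* (2 * N))
  (positions ∘ SecondClass.configuration {N} {p} {N*})

boundedInvolutions : (N p : ℕ) → Setoid 0ℓ 0ℓ
boundedInvolutions N p = On.setoid
  (Pointwise.setoid (setoid (Fin (2 * N))) (2 * N))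
  (_⟨$⟩ʳ_ ∘ BoundedInvolution.permutation {N} {p})

-- The proof uses Fomin's growth diagrams. Place the arcs (i , j), i < j, of an
-- involution in a staircase and let the corner (a , b) carry the shape grown from the
-- arcs with i < a and b ≤ j. On the diagonal a = b neighbouring shapes differ in one
-- box, so the diagonal is an oscillating tableau, which is a walker configuration: the
-- rows of the shape at time t are the displacements of the walkers.
--
-- Fomin's local rules can be stated for the edges alone, each labelled with the row
-- of the box gained along it, and they are invertible: the diagonal determines the
-- staircase, hence the arcs, and vice versa. Shapes are only needed to see that the
-- labels along the two outer sides are empty, so that every point lies on one arc.
--
-- Under the local rules the length of the first row obeys the recurrence for the
-- longest nesting i₁ < … < iₘ < jₘ < … < j₁, and the longest decreasing subsequence of
-- a fixed point free involution is twice as long as the longest nesting. So a bound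
-- 2p on the former bounds the displacement of the right-most walker by p. Conjugating
-- the shapes turns this into a bound p on the number of walkers that ever move.

module Submission where

open import Defs
open import Algebra.Definitions using (Involutive)
open import Data.Bool.Base using (Bool; true; false; T)
open import Data.Empty using (⊥-elim)
open import Data.Fin.Base as Fin using (Fin; toℕ; fromℕ; fromℕ<; inject₁; opposite)
import Data.Fin.Properties as Fin
open import Data.Fin.Properties
  using (toℕ<n; toℕ-fromℕ; toℕ-fromℕ<; toℕ-injective; toℕ-inject₁; opposite-prop; opposite-involutive)
open import Data.Fin.Permutation using (Permutation′; _⟨$⟩ʳ_; permutation)
open import Data.Integer.Base as ℤ using (1ℤ; ∣_∣; +≤+; +<+)
import Data.Integer.Properties as ℤ
open import Data.List.Base using ([]; _∷_; _++_; length; lookup; [_]; upTo)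
open import Data.List.Extrema.Nat using (argmax; argmax-all; f[xs]≤f[argmax])
open import Data.List.Membership.Propositional.Properties using (∈-lookup; ∈-upTo⁺; ∈-upTo⁻)
open import Data.List.Properties using (length-++)
open import Data.List.Relation.Unary.All as All using (All; []; _∷_)
import Data.List.Relation.Unary.All.Properties as All
open import Data.List.Relation.Unary.AllPairs using (AllPairs; []; _∷_)
import Data.List.Relation.Unary.AllPairs.Properties as AllPairs
open import Data.Maybe.Base using (Maybe; just; nothing)
open import Data.Nat.Base
open import Data.Nat.Properties
open import Data.Nat.Tactic.RingSolver using (solve-∀)
open import Data.Product.Base
open import Data.Sum.Base using (_⊎_; inj₁; inj₂)
open import Function.Base using (_∘_; case_of_)
open import Function.Bundles using (Bijection)
open import Function.Construct.Composition using (bijection)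
open import Level using (0ℓ)
open import Relation.Binary.Bundles using (Setoid)
open import Relation.Binary.Core using (_Preserves_⟶_; Rel)
open import Relation.Binary.Definitions using (tri<; tri≈; tri>)
open import Relation.Binary.PropositionalEquality hiding ([_])
open import Relation.Nullary
open import Relation.Nullary.Decidable using (dec-true; dec-false)

-- Shapes, edge labels and the local rules

Shape : Set
Shape = ℕ → ℕ

Label : Set
Label = Maybe ℕ

indicator : ℕ → ℕ → ℕ
indicator zero    zero    = 1
indicator zero    (suc k) = 0
indicator (suc r) zero    = 0
indicator (suc r) (suc k) = indicator r k

indicator-refl : ∀ r → indicator r r ≡ 1
indicator-refl zero    = refl
indicator-refl (suc r) = indicator-refl r

indicator-≢ : ∀ {r k} → r ≢ k → indicator r k ≡ 0
indicator-≢ {zero}  {zero}  r≢k = ⊥-elim (r≢k refl)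
indicator-≢ {zero}  {suc k} r≢k = refl
indicator-≢ {suc r} {zero}  r≢k = refl
indicator-≢ {suc r} {suc k} r≢k = indicator-≢ (λ r≡k → r≢k (cong suc r≡k))

indicator-≡1 : ∀ r k → indicator r k ≡ 1 → r ≡ k
indicator-≡1 zero    zero    _ = refl
indicator-≡1 (suc r) (suc k) e = cong suc (indicator-≡1 r k e)

boxes : Label → Shape
boxes nothing  k = 0
boxes (just r) k = indicator r k

infixl 6 _⊕_

_⊕_ : Shape → Label → Shape
(ρ ⊕ u) r = ρ r + boxes u r

Antitone : Shape → Set
Antitone ρ = ∀ r → ρ (suc r) ≤ ρ r

Antitone-resp-≗ : ∀ {ρ ρ′} → ρ ≗ ρ′ → Antitone ρ → Antitone ρ′
Antitone-resp-≗ eq anti r = subst₂ _≤_ (eq (suc r)) (eq r) (anti r)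

-- This holds as soon as one label is `nothing`, so that `pass` also covers the cells in which the
-- shape stays the same along a side.
Disjoint : Label → Label → Set
Disjoint u v = ∀ r → u ≡ just r → v ≢ just r

-- In Cell u v x u′ v′ the edges u and v leave the smallest corner ρ of the cell, and
-- u′ and v′ enter the largest one, u′ being opposite to u; x says if the cell holds an
-- arc.
data Cell : Label → Label → Bool → Label → Label → Set where
  cross : Cell nothing nothing true (just 0) (just 0)
  bump  : ∀ {r} → Cell (just r) (just r) false (just (suc r)) (just (suc r))
  pass  : ∀ {u v} → Disjoint u v → Cell u v false u v

-- Equal labels `just 0` can only come from an arc, equal labels `just (suc q)` only from a bump out
-- of row `q`; all other pairs have passed through unchanged.
back : Label → Label → Label × Label × Bool
back nothing  v        = nothing , v , false
back (just q) nothing  = just q , nothing , false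
back (just q) (just r) with q ≟ r
back (just q)       (just r) | no _  = just q , just r , false
back (just zero)    (just _) | yes _ = nothing , nothing , true
back (just (suc q)) (just _) | yes _ = just q , just q , false

-- The first clause ignores the incoming labels. It is a local rule only if both are `nothing`,
-- which `forth-cell` demands at an arc.
forth : Label → Label → Bool → Label × Label
forth u        v        true  = just 0 , just 0
forth nothing  v        false = nothing , v
forth (just q) nothing  false = just q , nothing
forth (just q) (just r) false with q ≟ r
... | yes _ = just (suc q) , just (suc q)
... | no _  = just q , just r

back-cell : ∀ u v → let (u₀ , v₀ , x) = back u v in Cell u₀ v₀ x u v
back-cell nothing  v        = pass λ _ ()
back-cell (just q) nothing  = pass λ _ _ ()
back-cell (just q) (just r) with q ≟ r
back-cell (just q)       (just r)       | no q≢r   = pass λ { _ refl refl → q≢r refl }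
back-cell (just zero)    (just .zero)   | yes refl = cross
back-cell (just (suc q)) (just .(suc q)) | yes refl = bump

cell-back : ∀ {u v x u′ v′} → Cell u v x u′ v′ → back u′ v′ ≡ (u , v , x)
cell-back cross = refl
cell-back (bump {r}) with suc r ≟ suc r
... | yes _ = refl
... | no ¬p = ⊥-elim (¬p refl)
cell-back (pass {nothing} {v} _) = refl
cell-back (pass {just q} {nothing} _) = refl
cell-back (pass {just q} {just r} disjoint) with q ≟ r
... | yes refl = ⊥-elim (disjoint q refl refl)
... | no _     = refl

forth-cell : ∀ u v x → (x ≡ true → u ≡ nothing × v ≡ nothing) →
             let (u′ , v′) = forth u v x in Cell u v x u′ v′
forth-cell u v true empty with refl , refl ← empty refl = cross
forth-cell nothing  v        false _ = pass λ _ ()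
forth-cell (just q) nothing  false _ = pass λ _ _ ()
forth-cell (just q) (just r) false _ with q ≟ r
... | yes refl = bump
... | no q≢r   = pass λ { _ refl refl → q≢r refl }

cell-forth : ∀ {u v x u′ v′} → Cell u v x u′ v′ → forth u v x ≡ (u′ , v′)
cell-forth cross = refl
cell-forth (bump {r}) with r ≟ r
... | yes _ = refl
... | no ¬p = ⊥-elim (¬p refl)
cell-forth (pass {nothing} {v} _) = refl
cell-forth (pass {just q} {nothing} _) = refl
cell-forth (pass {just q} {just r} disjoint) with q ≟ r
... | yes refl = ⊥-elim (disjoint q refl refl)
... | no _     = refl

-- The two ways round a cell, from its smallest to its largest corner, add the same boxes. Hence
-- shapes do not depend on the path along which they are grown.
conservation : ∀ {u v x u′ v′} → Cell u v x u′ v′ →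
               ∀ r → boxes v r + boxes u′ r ≡ boxes u r + boxes v′ r
conservation cross         r = refl
conservation bump          r = refl
conservation (pass {u} {v} _) r = +-comm (boxes v r) (boxes u r)

disjoint-boxes : ∀ {u v} → Disjoint u v → ∀ k → boxes u k ≡ 0 ⊎ boxes v k ≡ 0
disjoint-boxes {nothing}          _ k = inj₁ refl
disjoint-boxes {just q} {nothing} _ k = inj₂ refl
disjoint-boxes {just q} {just r} disjoint k with q ≟ k
... | no q≢k   = inj₁ (indicator-≢ q≢k)
... | yes refl = inj₂ (indicator-≢ {r} {q} λ { refl → disjoint q refl refl })

private
  drop-zero : ∀ {b} a → b ≡ 0 → a + b ≡ a
  drop-zero a refl = +-identityʳ a

  -- Taking a box away can spoil the order only between the row that loses it and the next one.
  -- Dually, adding a box can spoil it only between the row that gains it and the previous one.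
  ⊕-antitone-removable : ∀ {ρ} u k → Antitone (ρ ⊕ u) → boxes u k ≡ 0 → ρ (suc k) ≤ ρ k
  ⊕-antitone-removable {ρ} u k anti u≡0 = begin
    ρ (suc k)                   ≤⟨ m≤m+n _ _ ⟩
    ρ (suc k) + boxes u (suc k) ≤⟨ anti k ⟩
    ρ k + boxes u k             ≡⟨ drop-zero (ρ k) u≡0 ⟩
    ρ k                         ∎
    where open ≤-Reasoning

  ⊕-antitone-extensible : ∀ {ρ} v k → Antitone ρ → boxes v (suc k) ≡ 0 →
                          (ρ ⊕ v) (suc k) ≤ (ρ ⊕ v) k
  ⊕-antitone-extensible {ρ} v k anti v≡0 = begin
    ρ (suc k) + boxes v (suc k) ≡⟨ drop-zero (ρ (suc k)) v≡0 ⟩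
    ρ (suc k)                   ≤⟨ anti k ⟩
    ρ k                         ≤⟨ m≤m+n _ _ ⟩
    ρ k + boxes v k             ∎
    where open ≤-Reasoning

-- In a `pass` cell one of the two labels adds nothing to row `suc k`, and that label can be added
-- last. In a `bump` cell rows `r` and `suc r` of `ρ` both gain one box.
forth-antitone : ∀ {ρ u v x u′ v′} → Cell u v x u′ v′ →
                 Antitone ρ → Antitone (ρ ⊕ u) → Antitone (ρ ⊕ v) →
                 Antitone (ρ ⊕ u ⊕ v′)
forth-antitone cross _ antiμ _ k = ⊕-antitone-extensible (just 0) k antiμ refl
forth-antitone {ρ} (bump {r}) antiρ antiμ _ k with r ≟ k
... | no r≢k = ⊕-antitone-extensible (just (suc r)) k antiμ (indicator-≢ r≢k)
... | yes refl
  rewrite indicator-≢ (≢-sym (1+n≢n {r})) | indicator-≢ (1+n≢n {r}) | indicator-refl r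
        | +-identityʳ (ρ (suc r)) | +-identityʳ (ρ r + 1) = +-monoˡ-≤ 1 (antiρ r)
forth-antitone {ρ} (pass {u} {v} disjoint) antiρ antiμ antiν k
  with disjoint-boxes disjoint (suc k)
... | inj₂ v≡0 = ⊕-antitone-extensible v k antiμ v≡0
... | inj₁ u≡0 = subst₂ _≤_ (commute (suc k)) (commute k) (⊕-antitone-extensible u k antiν u≡0)
  where
  commute : ρ ⊕ v ⊕ u ≗ ρ ⊕ u ⊕ v
  commute r = trans (+-assoc (ρ r) _ _)
    (trans (cong (ρ r +_) (+-comm (boxes v r) _)) (sym (+-assoc (ρ r) _ _)))

infixl 6 _⊖_

-- The subtraction is truncated; `removable` shows that in a cell the box taken away is really
-- there.
_⊖_ : Shape → Label → Shape
(ν ⊖ v) r = ν r ∸ boxes v r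

module _ {lam μ ν : Shape} {u v x u′ v′} (cell : Cell u v x u′ v′)
         (antilam : Antitone lam) (antiμ : Antitone μ) (antiν : Antitone ν)
         (ν⊕u′ : lam ≗ ν ⊕ u′) (μ⊕v′ : lam ≗ μ ⊕ v′) where

  private
    -- In a `bump` cell the largest shape has a box in row `suc q`, hence one in row `q`, where it
    -- agrees with `ν`. In a `pass` cell the box of `v` lies in the largest shape by way of `μ`, and
    -- `u` did not put it there.
    removable : ∀ {u v x u′ v′} → Cell u v x u′ v′ →
                lam ≗ ν ⊕ u′ → lam ≗ μ ⊕ v′ → ∀ r → boxes v r ≤ ν r
    removable cross _ _ r = z≤n
    removable (bump {q}) ν⊕u′ _ r with q ≟ r
    ... | no q≢r rewrite indicator-≢ q≢r = z≤n
    ... | yes refl rewrite indicator-refl q = begin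
      1                             ≤⟨ m≤n+m 1 (ν (suc q)) ⟩
      ν (suc q) + 1                 ≡⟨ cong (ν (suc q) +_) (indicator-refl q) ⟨
      ν (suc q) + indicator q q     ≡⟨ ν⊕u′ (suc q) ⟨
      lam (suc q)                   ≤⟨ antilam q ⟩
      lam q                         ≡⟨ ν⊕u′ q ⟩
      ν q + indicator (suc q) q     ≡⟨ drop-zero (ν q) (indicator-≢ (1+n≢n {q})) ⟩
      ν q                           ∎
      where open ≤-Reasoning
    removable (pass {u} {v} disjoint) ν⊕u′ μ⊕v′ r with disjoint-boxes disjoint r
    ... | inj₂ v≡0 rewrite v≡0 = z≤n
    ... | inj₁ u≡0 = begin
      boxes v r       ≤⟨ m≤n+m _ (μ r) ⟩
      μ r + boxes v r ≡⟨ μ⊕v′ r ⟨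
      lam r           ≡⟨ ν⊕u′ r ⟩
      ν r + boxes u r ≡⟨ drop-zero (ν r) u≡0 ⟩
      ν r             ∎
      where open ≤-Reasoning

  ⊖-⊕ : ν ≗ ν ⊖ v ⊕ v
  ⊖-⊕ r = sym (m∸n+n≡m (removable cell ν⊕u′ μ⊕v′ r))

  ⊖-⊕′ : μ ≗ ν ⊖ v ⊕ u
  ⊖-⊕′ r = +-cancelʳ-≡ (boxes v′ r) _ _ (begin
    μ r + boxes v′ r                       ≡⟨ μ⊕v′ r ⟨
    lam r                                  ≡⟨ ν⊕u′ r ⟩
    ν r + boxes u′ r                       ≡⟨ cong (_+ boxes u′ r) (⊖-⊕ r) ⟩
    (ν ⊖ v) r + boxes v r + boxes u′ r     ≡⟨ +-assoc ((ν ⊖ v) r) _ _ ⟩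
    (ν ⊖ v) r + (boxes v r + boxes u′ r)   ≡⟨ cong ((ν ⊖ v) r +_) (conservation cell r) ⟩
    (ν ⊖ v) r + (boxes u r + boxes v′ r)   ≡⟨ +-assoc ((ν ⊖ v) r) _ _ ⟨
    (ν ⊖ v ⊕ u) r + boxes v′ r             ∎)
    where open ≡-Reasoning

  private
    -- Only row `r` of a `bump` cell is delicate: since `μ` can still gain a box in row `suc r`, its
    -- row `r` is strictly longer than its row `suc r`, which leaves room for removing the box of
    -- `u`.
    descends : ∀ {ρ u v x u′ v′} → Cell u v x u′ v′ → μ ≗ ρ ⊕ u → ν ≗ ρ ⊕ v →
               lam ≗ μ ⊕ v′ → Antitone ρ
    descends {ρ} cross μ≗ _ _ k =
      ⊕-antitone-removable {ρ} nothing k (Antitone-resp-≗ μ≗ antiμ) refl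
    descends {ρ} (bump {r}) μ≗ _ lam≗ k with r ≟ k
    ... | no r≢k = ⊕-antitone-removable {ρ} (just r) k (Antitone-resp-≗ μ≗ antiμ) (indicator-≢ r≢k)
    ... | yes refl = +-cancelʳ-≤ 1 _ _ (begin
      ρ (suc r) + 1                        ≤⟨ +-monoˡ-≤ 1 (m≤m+n (ρ (suc r)) (indicator r (suc r))) ⟩
      ρ (suc r) + indicator r (suc r) + 1  ≡⟨ cong₂ _+_ (μ≗ (suc r)) (indicator-refl r) ⟨
      μ (suc r) + indicator r r            ≡⟨ lam≗ (suc r) ⟨
      lam (suc r)                          ≤⟨ antilam r ⟩
      lam r                                ≡⟨ lam≗ r ⟩
      μ r + indicator (suc r) r            ≡⟨ drop-zero (μ r) (indicator-≢ (1+n≢n {r})) ⟩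
      μ r                                  ≡⟨ μ≗ r ⟩
      ρ r + indicator r r                  ≡⟨ cong (ρ r +_) (indicator-refl r) ⟩
      ρ r + 1                              ∎)
      where open ≤-Reasoning
    descends {ρ} (pass {u} {v} disjoint) μ≗ ν≗ _ k with disjoint-boxes disjoint k
    ... | inj₁ u≡0 = ⊕-antitone-removable {ρ} u k (Antitone-resp-≗ μ≗ antiμ) u≡0
    ... | inj₂ v≡0 = ⊕-antitone-removable {ρ} v k (Antitone-resp-≗ ν≗ antiν) v≡0

  ⊖-antitone : Antitone (ν ⊖ v)
  ⊖-antitone = descends cell ⊖-⊕′ ⊖-⊕ μ⊕v′

-- From oscillating tableaux to arcs

data Move : Set where
  up down : ℕ → Move

rise : Move → Label
rise (up r)   = just r
rise (down r) = nothing

fall : Move → Label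
fall (up r)   = nothing
fall (down r) = just r

-- A box added on one side or on the other, so that no subtraction is needed.
Moves : Move → Shape → Shape → Set
Moves m lam μ = lam ⊕ rise m ≗ μ ⊕ fall m

-- Both equations are compared in the row of one of the moves. The change of length there forces the
-- other move to act on the same row and in the same direction.
move-unique : ∀ {m m′ lam μ} → Moves m lam μ → Moves m′ lam μ → m ≡ m′
move-unique {up r} {up r′} {lam} {μ} s s′ = cong up (indicator-≡1 r r′
  (+-cancelˡ-≡ (lam r′) _ _ (trans (s r′) (trans (sym (s′ r′)) (cong (lam r′ +_) (indicator-refl r′))))))
move-unique {down r} {down r′} {lam} {μ} s s′ = cong down (indicator-≡1 r r′
  (+-cancelˡ-≡ (μ r′) _ _ (trans (sym (s r′)) (trans (s′ r′) (cong (μ r′ +_) (indicator-refl r′))))))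
move-unique {up r} {down r′} {lam} {μ} s s′ = ⊥-elim (<⇒≱ (m<n+m (lam r) z<s) (begin
  1 + lam r               ≡⟨ +-comm 1 (lam r) ⟩
  lam r + 1               ≡⟨ cong (lam r +_) (indicator-refl r) ⟨
  lam r + indicator r r   ≡⟨ s r ⟩
  μ r + 0                 ≤⟨ +-monoʳ-≤ (μ r) z≤n ⟩
  μ r + indicator r′ r    ≡⟨ s′ r ⟨
  lam r + 0               ≡⟨ +-identityʳ (lam r) ⟩
  lam r                   ∎))
  where open ≤-Reasoning
move-unique {down r} {up r′} s s′ = sym (move-unique s′ s)

-- Times beyond n are irrelevant.
record Oscillating (n : ℕ) (Allowed : Shape → Set) : Set where
  field
    shape    : ℕ → Shape
    move     : ℕ → Move
    starts   : ∀ r → shape 0 r ≡ 0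
    ends     : ∀ r → shape n r ≡ 0
    antitone : ∀ t → t ≤ n → Antitone (shape t)
    moves    : ∀ t → t < n → Moves (move t) (shape t) (shape (suc t))
    allowed  : ∀ t → t ≤ n → Allowed (shape t)

-- Only shapes are compared, because they determine the moves by `move-unique`.
oscillating : (n : ℕ) → (Shape → Set) → Setoid 0ℓ 0ℓ
oscillating n Allowed = record
  { Carrier       = Oscillating n Allowed
  ; _≈_           = λ o o′ → ∀ t → t ≤ n → shape o t ≗ shape o′ t
  ; isEquivalence = record
    { refl  = λ _ _ _ → refl
    ; sym   = λ e t t≤n r → sym (e t t≤n r)
    ; trans = λ e e′ t t≤n r → trans (e t t≤n r) (e′ t t≤n r)
    }
  }
  where open Oscillating

module Bumping {n : ℕ} {Allowed : Shape → Set} (osc : Oscillating n Allowed) where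
  open Oscillating osc

  -- For b = s + 1 + d, row s d labels the edge from (s , b) to (s + 1 , b); for
  -- t = s + d, column s d labels the edge from (s , t + 1) to (s , t).
  row column : ℕ → ℕ → Label
  row s zero       = rise (move s)
  row s (suc d)    = proj₁ (back (row s d) (column (suc s) d))
  column s zero    = fall (move s)
  column s (suc d) = proj₁ (proj₂ (back (row s d) (column (suc s) d)))

  crossed : ℕ → ℕ → Bool
  crossed s d = proj₂ (proj₂ (back (row s d) (column (suc s) d)))

  cell : ∀ s d → Cell (row s (suc d)) (column s (suc d)) (crossed s d) (row s d) (column (suc s) d)
  cell s d = back-cell (row s d) (column (suc s) d)

  -- The shape at the corner `(s , s + d)`, reached from the diagonal along column edges; `Valid`
  -- says that the row edges lead to the same shapes.
  inner : ℕ → ℕ → Shape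
  inner s zero    = shape s
  inner s (suc d) = inner s d ⊖ column s d

  record Valid (s d : ℕ) : Set where
    field
      column-edge : inner s d ≗ inner s (suc d) ⊕ column s d
      row-edge    : inner (suc s) d ≗ inner s (suc d) ⊕ row s d
      partition   : Antitone (inner s (suc d))
  open Valid

  private
    -- The corner next to two neighbouring diagonal shapes carries the smaller of them, so one of
    -- its two edges is blank and the other holds the box of the move.
    initially-valid : ∀ m {lam μ} → Moves m lam μ → Antitone lam → Antitone μ →
      lam ≗ lam ⊖ fall m ⊕ fall m × μ ≗ lam ⊖ fall m ⊕ rise m × Antitone (lam ⊖ fall m)
    initially-valid (up q) {lam} {μ} s antilam antiμ =
      (λ r → sym (+-identityʳ (lam r))) ,
      (λ r → trans (sym (+-identityʳ (μ r))) (sym (s r))) ,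
      antilam
    initially-valid (down q) {lam} {μ} s antilam antiμ =
      (λ r → trans (lam≡ r) (cong (_+ indicator q r) (sym (μ≡ r)))) ,
      (λ r → trans (sym (μ≡ r)) (sym (+-identityʳ (lam r ∸ indicator q r)))) ,
      Antitone-resp-≗ (λ r → sym (μ≡ r)) antiμ
      where
      lam≡ : ∀ r → lam r ≡ μ r + indicator q r
      lam≡ r = trans (sym (+-identityʳ (lam r))) (s r)
      μ≡ : ∀ r → lam r ∸ indicator q r ≡ μ r
      μ≡ r = trans (cong (_∸ indicator q r) (lam≡ r)) (m+n∸n≡m (μ r) (indicator q r))

  -- Induction on the distance `d` from the diagonal, inverting one local rule at a time; the bound
  -- keeps the cells inside the staircase.
  valid : ∀ d s → suc (s + d) ≤ n → Valid s d
  inner-antitone : ∀ d s → s + d ≤ n → Antitone (inner s d)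

  inner-antitone zero    s le = antitone s (subst (_≤ n) (+-identityʳ s) le)
  inner-antitone (suc d) s le = partition (valid d s (subst (_≤ n) (+-suc s d) le))

  valid zero s le = record
    { column-edge = proj₁ base
    ; row-edge    = proj₁ (proj₂ base)
    ; partition   = proj₂ (proj₂ base)
    }
    where
    s<n : s < n
    s<n = subst (λ m → suc m ≤ n) (+-identityʳ s) le
    base = initially-valid (move s) (moves s s<n) (antitone s (<⇒≤ s<n)) (antitone (suc s) s<n)
  valid (suc d) s le = record
    { column-edge = ⊖-⊕ {lam} {μ} {ν} (cell s d) a₁ a₂ a₃ e₁ e₂
    ; row-edge    = ⊖-⊕′ {lam} {μ} {ν} (cell s d) a₁ a₂ a₃ e₁ e₂
    ; partition   = ⊖-antitone {lam} {μ} {ν} (cell s d) a₁ a₂ a₃ e₁ e₂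
    }
    where
    lam = inner (suc s) d
    μ = inner (suc s) (suc d)
    ν = inner s (suc d)
    le′ : suc (suc s + d) ≤ n
    le′ = subst (λ m → suc m ≤ n) (+-suc s d) le
    v₀ = valid d s (<⇒≤ le′)
    v₁ = valid d (suc s) le′
    a₁ = inner-antitone d (suc s) (<⇒≤ le′)
    a₂ = partition v₁
    a₃ = partition v₀
    e₁ = row-edge v₀
    e₂ = column-edge v₁

  private
    no-boxes : ∀ u → (∀ r → boxes u r ≡ 0) → u ≡ nothing
    no-boxes nothing  _ = refl
    no-boxes (just r) e with () ← trans (sym (indicator-refl r)) (e r)

    left-empty : ∀ d r → inner 0 d r ≡ 0
    left-empty zero    r = starts r
    left-empty (suc d) r = trans (cong (_∸ boxes (column 0 d) r) (left-empty d r)) (0∸n≡0 (boxes (column 0 d) r))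

    -- Along the outer side `b = n` the shapes only grow towards the final shape of the tableau,
    -- which is empty.
    top-empty : ∀ d s → s + d ≡ n → ∀ r → inner s d r ≡ 0
    top-empty zero    s eq r = trans (cong (λ m → shape m r) (trans (sym (+-identityʳ s)) eq)) (ends r)
    top-empty (suc d) s eq r = m+n≡0⇒m≡0 _
      (trans (sym (row-edge (valid d s (≤-reflexive eq′)) r)) (top-empty d (suc s) eq′ r))
      where
      eq′ : suc (s + d) ≡ n
      eq′ = trans (sym (+-suc s d)) eq

  left-column : ∀ d → d < n → column 0 d ≡ nothing
  left-column d d<n = no-boxes _ λ r →
    m+n≡0⇒n≡0 (inner 0 (suc d) r) (trans (sym (column-edge (valid d 0 d<n) r)) (left-empty d r))

  top-row : ∀ s d → suc (s + d) ≡ n → row s d ≡ nothing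
  top-row s d eq = no-boxes _ λ r →
    m+n≡0⇒n≡0 (inner s (suc d) r)
      (trans (sym (row-edge (valid d s (≤-reflexive eq)) r)) (top-empty d (suc s) eq r))

  Crossed : ℕ → ℕ → Set
  Crossed s d = crossed s d ≡ true

  private
    inv-crossed : ∀ {u v x u′ v′} → Cell u v x u′ v′ → x ≡ true →
                  (u ≡ nothing × v ≡ nothing) × (u′ ≡ just 0 × v′ ≡ just 0)
    inv-crossed cross _ = (refl , refl) , (refl , refl)

    -- Read outwards from the diagonal, a label is kept, lowered by one or, exactly at an arc,
    -- dropped; it never appears out of nothing. So a row or column meets at most one arc.
    row-vanishes : ∀ {u v x u′ v′} → Cell u v x u′ v′ → u′ ≡ nothing → u ≡ nothing
    row-vanishes (pass _) e = e

    column-vanishes : ∀ {u v x u′ v′} → Cell u v x u′ v′ → v′ ≡ nothing → v ≡ nothing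
    column-vanishes (pass _) e = e

    row-created : ∀ {u v x u′ v′ r} → Cell u v x u′ v′ → u ≡ nothing → u′ ≡ just r → x ≡ true
    row-created cross _ _ = refl
    row-created (pass _) refl ()

    column-created : ∀ {u v x u′ v′ r} → Cell u v x u′ v′ → v ≡ nothing → v′ ≡ just r → x ≡ true
    column-created cross _ _ = refl
    column-created (pass _) refl ()

    row-vanishes* : ∀ s d e → row s d ≡ nothing → row s (e + d) ≡ nothing
    row-vanishes* s d zero    z = z
    row-vanishes* s d (suc e) z = row-vanishes (cell s (e + d)) (row-vanishes* s d e z)

    column-vanishes* : ∀ s d e → column (e + s) d ≡ nothing → column s (e + d) ≡ nothing
    column-vanishes* s d zero    z = z
    column-vanishes* s d (suc e) z = subst (λ m → column s m ≡ nothing) (+-suc e d)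
      (column-vanishes* s (suc d) e (column-vanishes (cell (e + s) d) z))

  -- A label that is present on the diagonal and absent at distance `d` was dropped in between,
  -- which happens only at an arc. In `column-search` the sum `s + d` stays fixed instead of `s`.
  row-search : ∀ s d {r} → row s 0 ≡ just r → row s d ≡ nothing → ∃[ d′ ] d′ < d × Crossed s d′
  row-search s zero    j z with () ← trans (sym j) z
  row-search s (suc d) j z with row s d in eq
  ... | just _  = d , n<1+n d , row-created (cell s d)
                    (subst (λ u → proj₁ (back u (column (suc s) d)) ≡ nothing) (sym eq) z) eq
  ... | nothing with d′ , d′<d , c ← row-search s d j eq = d′ , m<n⇒m<1+n d′<d , c

  column-search : ∀ d s {r} → column (s + d) 0 ≡ just r → column s d ≡ nothing →
                  ∃[ s′ ] ∃[ d′ ] suc (s′ + d′) ≡ s + d × Crossed s′ d′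
  column-search zero    s j z
    with () ← trans (sym j) (subst (λ m → column m 0 ≡ nothing) (sym (+-identityʳ s)) z)
  column-search (suc d) s {r} j z with column (suc s) d in eq
  ... | just _  = s , d , sym (+-suc s d) , column-created (cell s d)
                    (subst (λ v → proj₁ (proj₂ (back (row s d) v)) ≡ nothing) (sym eq) z) eq
  ... | nothing
    with s′ , d′ , e , c ← column-search d (suc s) (subst (λ m → column m 0 ≡ just r) (+-suc s d) j) eq
    = s′ , d′ , trans e (sym (+-suc s d)) , c

  row-crossed : ∀ s d → Crossed s d → row s d ≡ just 0
  row-crossed s d c = proj₁ (proj₂ (inv-crossed (cell s d) c))

  column-crossed : ∀ s d → Crossed s d → column (suc s) d ≡ just 0
  column-crossed s d c = proj₂ (proj₂ (inv-crossed (cell s d) c))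

  private
    row-beyond : ∀ s d → Crossed s d → row s (suc d) ≡ nothing
    row-beyond s d c = proj₁ (proj₁ (inv-crossed (cell s d) c))

    column-beyond : ∀ s d → Crossed s d → column s (suc d) ≡ nothing
    column-beyond s d c = proj₂ (proj₁ (inv-crossed (cell s d) c))

    just≢nothing : ∀ {u : Label} {r} → u ≡ just r → u ≢ nothing
    just≢nothing refl ()

    -- Beyond its first arc the row is blank, but a second arc would need the label `just 0` there.
    row-clash : ∀ s d d′ → Crossed s d → Crossed s d′ → ¬ d < d′
    row-clash s d d′ c c′ d<d′ = just≢nothing (row-crossed s d′ c′)
      (subst (λ m → row s m ≡ nothing) (m∸n+n≡m d<d′) (row-vanishes* s (suc d) (d′ ∸ suc d) (row-beyond s d c)))

    column-clash : ∀ s d s′ d′ → Crossed s d → Crossed s′ d′ → s + d ≡ s′ + d′ → ¬ s′ < s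
    column-clash s d s′ d′ c c′ eq s′<s = just≢nothing (column-crossed s′ d′ c′)
      (subst (λ m → column (suc s′) m ≡ nothing) d-eq
        (column-vanishes* (suc s′) (suc d) e
          (subst (λ m → column m (suc d) ≡ nothing) (sym (m∸n+n≡m s′<s)) (column-beyond s d c))))
      where
      e = s ∸ suc s′
      d-eq : e + suc d ≡ d′
      d-eq = +-cancelˡ-≡ s′ _ _ (begin
        s′ + (e + suc d)   ≡⟨ cong (s′ +_) (+-suc e d) ⟩
        s′ + suc (e + d)   ≡⟨ +-suc s′ (e + d) ⟩
        suc s′ + (e + d)   ≡⟨ +-assoc (suc s′) e d ⟨
        suc s′ + e + d     ≡⟨ cong (_+ d) (trans (+-comm (suc s′) e) (m∸n+n≡m s′<s)) ⟩
        s + d              ≡⟨ eq ⟩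
        s′ + d′            ∎)
        where open ≡-Reasoning

  Arc : ℕ → ℕ → Set
  Arc s t = ∃[ d ] t ≡ suc (s + d) × Crossed s d

  arc-functional : ∀ {s t t′} → Arc s t → Arc s t′ → t ≡ t′
  arc-functional (d , refl , c) (d′ , refl , c′) with <-cmp d d′
  ... | tri< d<d′ _ _ = ⊥-elim (row-clash _ d d′ c c′ d<d′)
  ... | tri≈ _ refl _ = refl
  ... | tri> _ _ d′<d = ⊥-elim (row-clash _ d′ d c′ c d′<d)

  arc-injective : ∀ {s s′ t} → Arc s t → Arc s′ t → s ≡ s′
  arc-injective {s} {s′} (d , refl , c) (d′ , eq , c′) with <-cmp s s′
  ... | tri< s<s′ _ _ = ⊥-elim (column-clash s′ d′ s d c′ c (sym (suc-injective eq)) s<s′)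
  ... | tri≈ _ s≡s′ _ = s≡s′
  ... | tri> _ _ s′<s = ⊥-elim (column-clash s d s′ d′ c c′ (suc-injective eq) s′<s)

  private
    -- The label that an arc consumes must already be present on the diagonal. So an arc opens at an
    -- `up` and closes at a `down`, and no point can do both.
    opens : ∀ {s t} → Arc s t → rise (move s) ≢ nothing
    opens {s} (d , _ , c) z = just≢nothing (row-crossed s d c)
      (subst (λ m → row s m ≡ nothing) (+-identityʳ d) (row-vanishes* s 0 d z))

    closes : ∀ {s t} → Arc s t → fall (move t) ≢ nothing
    closes {s} (d , refl , c) z = just≢nothing (column-crossed s d c)
      (subst (λ m → column (suc s) m ≡ nothing) (+-identityʳ d)
        (column-vanishes* (suc s) 0 d (subst (λ m → column m 0 ≡ nothing)
          (trans (cong suc (+-comm s d)) (sym (+-suc d s))) z)))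

  arc-disjoint : ∀ {s t u} → Arc s t → ¬ Arc u s
  arc-disjoint {s} a b with move s | opens a | closes b
  ... | up _   | _ | c = c refl
  ... | down _ | o | _ = o refl

  Linked : ℕ → ℕ → Set
  Linked i j = Arc i j ⊎ Arc j i

  linked-functional : ∀ {i j k} → Linked i j → Linked i k → j ≡ k
  linked-functional (inj₁ a) (inj₁ b) = arc-functional a b
  linked-functional (inj₁ a) (inj₂ b) = ⊥-elim (arc-disjoint a b)
  linked-functional (inj₂ a) (inj₁ b) = ⊥-elim (arc-disjoint b a)
  linked-functional (inj₂ a) (inj₂ b) = arc-injective a b

  linked-irreflexive : ∀ {i} → ¬ Linked i i
  linked-irreflexive (inj₁ a) = arc-disjoint a a
  linked-irreflexive (inj₂ a) = arc-disjoint a a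

  linked-sym : ∀ {i j} → Linked i j → Linked j i
  linked-sym (inj₁ a) = inj₂ a
  linked-sym (inj₂ a) = inj₁ a

  linked-total : ∀ i → i < n → ∃[ j ] j < n × Linked i j
  linked-total i i<n with move i in eq
  -- The outer side is at distance `n ∸ suc i` along the row and at `s = 0` along the column; the
  -- label of the move is gone there.
  ... | up r
    with d , d<e , c ← row-search i (n ∸ suc i) (cong rise eq) (top-row i (n ∸ suc i) (m+[n∸m]≡n i<n))
      = suc (i + d) , subst (suc i + d <_) (m+[n∸m]≡n i<n) (+-monoʳ-< (suc i) d<e) , inj₁ (d , refl , c)
  ... | down r
    with s , d , e , c ← column-search i 0 (cong fall eq) (left-column i i<n)
      = s , <-trans (s≤s (m≤m+n s d)) (subst (_< n) (sym e) i<n) , inj₂ (d , sym e , c)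

-- From involutions to oscillating tableaux

private
  forth-row-just : ∀ q v → ∃[ r ] proj₁ (forth (just q) v false) ≡ just r
  forth-row-just q nothing  = q , refl
  forth-row-just q (just r) with q ≟ r
  ... | yes _ = suc q , refl
  ... | no _  = q , refl

  forth-column-nothing : ∀ u → proj₂ (forth u nothing false) ≡ nothing
  forth-column-nothing nothing  = refl
  forth-column-nothing (just q) = refl

  forth-column-just : ∀ u r → ∃[ q ] proj₂ (forth u (just r) false) ≡ just q
  forth-column-just nothing  r = r , refl
  forth-column-just (just q) r with q ≟ r
  ... | yes _ = suc q , refl
  ... | no _  = r , refl

  -- Without an arc, the first row of the largest corner is that of one of its two neighbours. This
  -- is the recurrence for the longest nesting.
  cell-first-row : ∀ {u v x u′ v′} → Cell u v x u′ v′ →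
                   x ≡ true ⊎ boxes u′ 0 ≡ 0 ⊎ boxes v′ 0 ≡ 0
  cell-first-row cross           = inj₁ refl
  cell-first-row bump            = inj₂ (inj₁ refl)
  cell-first-row (pass disjoint) = inj₂ (disjoint-boxes disjoint 0)

  -- On the diagonal exactly one of the two labels is present; the last clause is junk.
  combine : Label → Label → Move
  combine (just r) _        = up r
  combine nothing  (just r) = down r
  combine nothing  nothing  = up 0

module Growth (n : ℕ) (σ : ℕ → ℕ) (σ-< : ∀ {i} → i < n → σ i < n)
              (σ-involutive : ∀ {i} → i < n → σ (σ i) ≡ i)
              (σ-fixedPointFree : ∀ {i} → i < n → σ i ≢ i) where

  -- The number of points beyond the partner of i.
  depth : ℕ → ℕ
  depth i = n ∸ suc (σ i)

  depth-sum : ∀ {i} → i < n → suc (σ i + depth i) ≡ n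
  depth-sum i<n = m+[n∸m]≡n (σ-< i<n)

  depth-unique : ∀ {i j k} → i < n → suc (j + k) ≡ n → depth i ≡ k → σ i ≡ j
  depth-unique {i} {j} {k} i<n e refl = +-cancelʳ-≡ k _ _ (suc-injective (trans (depth-sum i<n) (sym e)))

  σ-unique : ∀ {i j k} → suc (j + k) ≡ n → σ i ≡ j → depth i ≡ k
  σ-unique {i} {j} {k} refl refl = m+n∸m≡n (suc j) k

  depth-injective : ∀ {i j} → i < n → j < n → depth i ≡ depth j → i ≡ j
  depth-injective i<n j<n e =
    trans (sym (σ-involutive i<n)) (trans (cong σ (depth-unique i<n (depth-sum j<n) e)) (σ-involutive j<n))

  crossing : ℕ → ℕ → Bool
  crossing s k = does (depth s ≟ k)

  crossing-depth : ∀ s k → crossing s k ≡ true → depth s ≡ k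
  crossing-depth s k e = ≡ᵇ⇒≡ (depth s) k (subst T (sym e) _)

  no-crossing : ∀ s k → crossing s k ≡ false → depth s ≢ k
  no-crossing s k x d≡k with () ← trans (sym x) (dec-true (depth s ≟ k) d≡k)

  -- The labels as in Bumping, for b = n - k and t + 1 = n - k, but computed from the
  -- outer sides of the whole square, which is simpler than stopping at the diagonal.
  row column : ℕ → ℕ → Label
  row s zero       = nothing
  row s (suc k)    = proj₁ (forth (row s k) (column s k) (crossing s k))
  column zero k    = nothing
  column (suc s) k = proj₂ (forth (row s k) (column s k) (crossing s k))

  -- Labels arise only at arcs and never vanish on the way inwards. This and the next three lemmas
  -- therefore decide from the position of the arcs alone which labels are present.
  row-nothing : ∀ s k → k ≤ depth s → row s k ≡ nothing
  row-nothing s zero    _  = refl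
  row-nothing s (suc k) le
    rewrite row-nothing s k (<⇒≤ le) | dec-false (depth s ≟ k) (>⇒≢ le) = refl

  row-just : ∀ s k → depth s < k → ∃[ r ] row s k ≡ just r
  row-just s (suc k) lt with crossing s k in x
  ... | true = 0 , refl
  ... | false
    with r , e ← row-just s k (≤∧≢⇒< (≤-pred lt) (no-crossing s k x))
    rewrite e = forth-row-just r (column s k)

  column-nothing : ∀ s k → (∀ i → i < s → depth i ≢ k) → column s k ≡ nothing
  column-nothing zero    k _ = refl
  column-nothing (suc s) k d≢k
    rewrite column-nothing s k (λ i i<s → d≢k i (m<n⇒m<1+n i<s))
          | dec-false (depth s ≟ k) (d≢k s (n<1+n s)) = forth-column-nothing (row s k)

  column-just : ∀ s k i → i < s → depth i ≡ k → ∃[ r ] column s k ≡ just r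
  column-just (suc s) k i i<s d≡k with crossing s k in x
  ... | true = 0 , refl
  ... | false
    with r , e ← column-just s k i (≤∧≢⇒< (≤-pred i<s) λ { refl → no-crossing s k x d≡k }) d≡k
    rewrite e = forth-column-just (row s k) r

  cell : ∀ s k → s < n → Cell (row s k) (column s k) (crossing s k) (row s (suc k)) (column (suc s) k)
  cell s k s<n = forth-cell (row s k) (column s k) (crossing s k) λ e →
    case crossing-depth s k e of λ d≡k →
      row-nothing s k (≤-reflexive (sym d≡k)) ,
      column-nothing s k λ i i<s d → <⇒≢ i<s (depth-injective (<-trans i<s s<n) s<n (trans d (sym d≡k)))

  -- The shape at the corner `(s , n - k)`, summed along the rows from the empty side;
  -- `outer-column` gives the column edges.
  outer : ℕ → ℕ → Shape
  outer zero    k r = 0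
  outer (suc s) k   = outer s k ⊕ row s k

  outer-column : ∀ s k → s ≤ n → outer s (suc k) ≗ outer s k ⊕ column s k
  outer-column zero    k _   r = refl
  outer-column (suc s) k s<n r = begin
    outer s (suc k) r + boxes (row s (suc k)) r
      ≡⟨ cong (_+ boxes (row s (suc k)) r) (outer-column s k (<⇒≤ s<n) r) ⟩
    outer s k r + boxes (column s k) r + boxes (row s (suc k)) r
      ≡⟨ +-assoc (outer s k r) _ _ ⟩
    outer s k r + (boxes (column s k) r + boxes (row s (suc k)) r)
      ≡⟨ cong (outer s k r +_) (conservation (cell s k s<n) r) ⟩
    outer s k r + (boxes (row s k) r + boxes (column (suc s) k) r)
      ≡⟨ +-assoc (outer s k r) _ _ ⟨
    outer s k r + boxes (row s k) r + boxes (column (suc s) k) r ∎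
    where open ≡-Reasoning

  outer-antitone : ∀ s k → s ≤ n → Antitone (outer s k)
  outer-antitone zero    k       _   r = z≤n
  outer-antitone (suc s) zero    s<n = Antitone-resp-≗ (λ r → sym (+-identityʳ (outer s 0 r)))
    (outer-antitone s zero (<⇒≤ s<n))
  outer-antitone (suc s) (suc k) s<n =
    Antitone-resp-≗ (λ r → sym (outer-column (suc s) k s<n r))
      (forth-antitone (cell s k s<n) (outer-antitone s k (<⇒≤ s<n)) (outer-antitone (suc s) k s<n)
        (Antitone-resp-≗ (outer-column s k (<⇒≤ s<n)) (outer-antitone s (suc k) (<⇒≤ s<n))))

  shape : ℕ → Shape
  shape t = outer t (n ∸ t)

  move : ℕ → Move
  move t = combine (row t (n ∸ suc t)) (column t (n ∸ suc t))

  -- If `σ t < t`, the column at `t` has already met its arc and the row has not; if `t < σ t`, it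
  -- is the other way round. Without fixed points exactly one label is present.
  move-labels : ∀ t → t < n → rise (move t) ≡ row t (n ∸ suc t) × fall (move t) ≡ column t (n ∸ suc t)
  move-labels t t<n with <-cmp (σ t) t
  ... | tri≈ _ σt≡t _ = ⊥-elim (σ-fixedPointFree t<n σt≡t)
  ... | tri< σt<t _ _
    with r , e ← column-just t (n ∸ suc t) (σ t) σt<t (cong (λ i → n ∸ suc i) (σ-involutive t<n))
    rewrite row-nothing t (n ∸ suc t) (∸-monoʳ-≤ n (<⇒≤ (s<s σt<t))) | e = refl , refl
  ... | tri> _ _ t<σt
    with r , e ← row-just t (n ∸ suc t) (∸-monoʳ-< (s<s t<σt) (σ-< t<n))
    rewrite e = refl , sym (column-nothing t (n ∸ suc t) λ i i<t d →
      <⇒≱ t<σt (<⇒≤ (subst (_< t) (trans (sym (σ-involutive (<-trans i<t t<n)))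
        (cong σ (depth-unique (<-trans i<t t<n) (m+[n∸m]≡n t<n) d))) i<t)))

  shape-moves : ∀ t → t < n → Moves (move t) (shape t) (shape (suc t))
  shape-moves t t<n r with er , ec ← move-labels t t<n
    rewrite er | ec | +-∸-assoc 1 t<n = begin
      outer t (suc k) r + boxes (row t k) r
        ≡⟨ cong (_+ boxes (row t k) r) (outer-column t k (<⇒≤ t<n) r) ⟩
      outer t k r + boxes (column t k) r + boxes (row t k) r
        ≡⟨ +-assoc (outer t k r) _ _ ⟩
      outer t k r + (boxes (column t k) r + boxes (row t k) r)
        ≡⟨ cong (outer t k r +_) (+-comm (boxes (column t k) r) _) ⟩
      outer t k r + (boxes (row t k) r + boxes (column t k) r)
        ≡⟨ +-assoc (outer t k r) _ _ ⟨
      outer t k r + boxes (row t k) r + boxes (column t k) r ∎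
    where
    open ≡-Reasoning
    k = n ∸ suc t

  shape-ends : ∀ r → shape n r ≡ 0
  shape-ends r rewrite n∸n≡0 n = empty n
    where
    empty : ∀ s → outer s 0 r ≡ 0
    empty zero    = refl
    empty (suc s) rewrite empty s = refl

  oscillation : ∀ {Allowed} → (∀ t → t ≤ n → Allowed (shape t)) → Oscillating n Allowed
  oscillation allowed = record
    { shape    = shape
    ; move     = move
    ; starts   = λ _ → refl
    ; ends     = shape-ends
    ; antitone = λ t t≤n → outer-antitone t (n ∸ t) t≤n
    ; moves    = shape-moves
    ; allowed  = allowed
    }

  -- Nestings and the length of the first row

  outer-mono : ∀ {s s′ k k′} r → s′ ≤ n → s ≤ s′ → k ≤ k′ → outer s k r ≤ outer s′ k′ r
  outer-mono {s} {s′} {k} {k′} r s′≤n s≤s′ k≤k′ =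
    ≤-trans (rows (≤⇒≤′ s≤s′)) (columns (≤⇒≤′ k≤k′))
    where
    rows : ∀ {s′} → s ≤′ s′ → outer s k r ≤ outer s′ k r
    rows (≤′-reflexive refl) = ≤-refl
    rows (≤′-step le) = ≤-trans (rows le) (m≤m+n _ _)
    columns : ∀ {k′} → k ≤′ k′ → outer s′ k r ≤ outer s′ k′ r
    columns (≤′-reflexive refl) = ≤-refl
    columns {suc k′} (≤′-step le) = ≤-trans (columns le)
      (≤-trans (m≤m+n _ _) (≤-reflexive (sym (outer-column s′ k′ s′≤n r))))

  -- A nesting of m arcs, the innermost one added last, within the first s rows
  -- and the last k columns.
  data Nesting : ℕ → ℕ → ℕ → Set where
    []   : ∀ {s k} → Nesting 0 s k
    snoc : ∀ {m s k} i → Nesting m i (depth i) → i < s → depth i < k → Nesting (suc m) s k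

  -- The cell of the innermost arc lengthens the first row by one beyond what the enclosing arcs
  -- give, and from there on shapes only grow.
  nesting-bound : ∀ {m s k} → s ≤ n → Nesting m s k → m ≤ outer s k 0
  nesting-bound _ [] = z≤n
  nesting-bound {suc m} {s} {k} s≤n (snoc i nest i<s d<k) = begin
    suc m
      ≡⟨ +-comm 1 m ⟩
    m + 1
      ≤⟨ +-monoˡ-≤ 1 (nesting-bound (<⇒≤ i<n) nest) ⟩
    outer i (depth i) 0 + 1
      ≡⟨ cong (_+ 1) (+-identityʳ _) ⟨
    outer i (depth i) 0 + 0 + 1
      ≡⟨ cong₂ (λ u u′ → outer i (depth i) 0 + boxes u 0 + boxes u′ 0) no-column new-row ⟨
    (outer i (depth i) ⊕ column i (depth i) ⊕ row i (suc (depth i))) 0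
      ≡⟨ cong (_+ boxes (row i (suc (depth i))) 0) (outer-column i (depth i) (<⇒≤ i<n) 0) ⟨
    outer (suc i) (suc (depth i)) 0
      ≤⟨ outer-mono 0 s≤n i<s d<k ⟩
    outer s k 0 ∎
    where
    open ≤-Reasoning
    i<n = <-≤-trans i<s s≤n
    no-column : column i (depth i) ≡ nothing
    no-column = column-nothing i (depth i) λ j j<i d → <⇒≢ j<i (depth-injective (<-trans j<i i<n) i<n d)
    new-row : row i (suc (depth i)) ≡ just 0
    new-row rewrite dec-true (depth i ≟ depth i) refl = refl

  nesting-widen : ∀ {m s s′ k k′} → s ≤ s′ → k ≤ k′ → Nesting m s k → Nesting m s′ k′
  nesting-widen _    _    []                      = []
  nesting-widen s≤s′ k≤k′ (snoc i nest i<s d<k) = snoc i nest (<-≤-trans i<s s≤s′) (<-≤-trans d<k k≤k′)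

  -- Traces the recurrence back: at an arc the nesting gains this arc, elsewhere it comes from the
  -- neighbour with the same first row.
  longest-nesting : ∀ s k → s ≤ n → Nesting (outer s k 0) s k
  longest-nesting zero    k       _   = []
  longest-nesting (suc s) zero    s<n = subst (λ m → Nesting m (suc s) 0) (sym (+-identityʳ (outer s 0 0)))
    (nesting-widen (n≤1+n s) ≤-refl (longest-nesting s zero (<⇒≤ s<n)))
  longest-nesting (suc s) (suc k) s<n with cell-first-row (cell s k s<n)
  ... | inj₂ (inj₁ u≡0) = subst (λ m → Nesting m (suc s) (suc k))
          (sym (trans (cong (outer s (suc k) 0 +_) u≡0) (+-identityʳ _)))
          (nesting-widen (n≤1+n s) ≤-refl (longest-nesting s (suc k) (<⇒≤ s<n)))
  ... | inj₂ (inj₂ v≡0) = subst (λ m → Nesting m (suc s) (suc k))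
          (sym (trans (outer-column (suc s) k s<n 0) (trans (cong (outer (suc s) k 0 +_) v≡0) (+-identityʳ _))))
          (nesting-widen ≤-refl (n≤1+n k) (longest-nesting (suc s) k s<n))
  ... | inj₁ x with refl ← crossing-depth s k x = subst (λ m → Nesting m (suc s) (suc k)) (sym size)
          (snoc s (longest-nesting s k (<⇒≤ s<n)) (n<1+n s) (n<1+n k))
    where
    size : outer (suc s) (suc k) 0 ≡ suc (outer s k 0)
    size rewrite outer-column s k (<⇒≤ s<n) 0
               | column-nothing s k (λ j j<s d → <⇒≢ j<s (depth-injective (<-trans j<s s<n) s<n d))
               | x | +-identityʳ (outer s k 0) = +-comm (outer s k 0) 1

-- Nestings and decreasing subsequences of an involution

extend : ∀ {n} → (Fin n → ℕ) → ℕ → ℕ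
-- Indices below `n` never see this default; for the rows of a shape it is the correct value beyond.
extend {zero}  f _       = 0
extend {suc n} f zero    = f Fin.zero
extend {suc n} f (suc i) = extend (f ∘ Fin.suc) i

extend-toℕ : ∀ {n} (f : Fin n → ℕ) i → extend f (toℕ i) ≡ f i
extend-toℕ f Fin.zero    = refl
extend-toℕ f (Fin.suc i) = extend-toℕ (f ∘ Fin.suc) i

extend-fromℕ< : ∀ {n} (f : Fin n → ℕ) {i} (i<n : i < n) → extend f i ≡ f (fromℕ< i<n)
extend-fromℕ< f i<n = trans (cong (extend f) (sym (toℕ-fromℕ< i<n))) (extend-toℕ f (fromℕ< i<n))

maximum-upTo : (f : ℕ → ℕ) → ∀ n → ∃[ m ] m ≤ n × (∀ {i} → i ≤ n → f i ≤ f m)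
maximum-upTo f n = argmax f 0 (upTo (suc n)) ,
  argmax-all f {P = _≤ n} z≤n (All.tabulate {xs = upTo (suc n)} (≤-pred ∘ ∈-upTo⁻)) ,
  λ i≤n → All.lookup (f[xs]≤f[argmax] {f = f} 0 (upTo (suc n))) (∈-upTo⁺ (s≤s i≤n))

AllPairs-lookup : ∀ {a ℓ} {A : Set a} {R : Rel A ℓ} {xs} → AllPairs R xs →
                  ∀ {i j} → i Fin.< j → R (lookup xs i) (lookup xs j)
AllPairs-lookup (rs ∷ _) {Fin.zero}  {Fin.suc j} _         = All.lookup rs (∈-lookup j)
AllPairs-lookup (_ ∷ ps) {Fin.suc i} {Fin.suc j} (s≤s i<j) = AllPairs-lookup ps i<j

module FixedPointFree {n : ℕ} (π : Permutation′ n) (involutive : Involutive _≡_ (π ⟨$⟩ʳ_))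
                      (fixedPointFree : ∀ i → π ⟨$⟩ʳ i ≢ i) where

  σ : ℕ → ℕ
  σ = extend (toℕ ∘ (π ⟨$⟩ʳ_))

  σ-toℕ : ∀ i → σ (toℕ i) ≡ toℕ (π ⟨$⟩ʳ i)
  σ-toℕ = extend-toℕ (toℕ ∘ (π ⟨$⟩ʳ_))

  private
    onFin : (P : ℕ → Set) → (∀ i → P (toℕ i)) → ∀ {i} → i < n → P i
    onFin P p i<n = subst P (toℕ-fromℕ< i<n) (p (fromℕ< i<n))

  σ-< : ∀ {i} → i < n → σ i < n
  σ-< = onFin (λ i → σ i < n) λ i → subst (_< n) (sym (σ-toℕ i)) (toℕ<n _)

  σ-involutive : ∀ {i} → i < n → σ (σ i) ≡ i
  σ-involutive = onFin (λ i → σ (σ i) ≡ i) λ i →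
    trans (cong σ (σ-toℕ i)) (trans (σ-toℕ _) (cong toℕ (involutive i)))

  σ-fixedPointFree : ∀ {i} → i < n → σ i ≢ i
  σ-fixedPointFree = onFin (λ i → σ i ≢ i) λ i e →
    fixedPointFree i (toℕ-injective (trans (sym (σ-toℕ i)) e))

  open Growth n σ σ-< σ-involutive σ-fixedPointFree public

  private
    Precedes : Rel (Fin n) 0ℓ
    Precedes i j = i Fin.< j × (π ⟨$⟩ʳ i) Fin.> (π ⟨$⟩ʳ j)

    -- Positions and values share one window, so that an enclosing arc fits on both counts: its
    -- opening comes earlier with a larger value, its closing later with a smaller one.
    Within : ℕ → ℕ → Fin n → Set
    Within s e i = (s ≤ toℕ i × toℕ i < e) × (s ≤ toℕ (π ⟨$⟩ʳ i) × toℕ (π ⟨$⟩ʳ i) < e)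

    -- The result is i₁ … iₘ xs π(iₘ) … π(i₁), built from the innermost arc outwards.
    wrap : ∀ {m s k} e xs → Nesting m s k → s ≤ e → e + k ≡ n →
           All (Within s e) xs → AllPairs Precedes xs →
           ∃[ ys ] length ys ≡ m + m + length xs × AllPairs Precedes ys
    wrap e xs [] _ _ _ ps = xs , refl , ps
    wrap {suc m} {s} {k} e xs (snoc i nest i<s d<k) s≤e e+k≡n within ps
      with fromℕ< i<n | toℕ-fromℕ< i<n
      where
      i<n : i < n
      i<n = <-≤-trans i<s (≤-trans s≤e (≤-trans (m≤m+n e k) (≤-reflexive e+k≡n)))
    -- The new window runs from `x` to its partner `y`, and the invariant `e + k ≡ n` persists
    -- because `depth` counts the points beyond `y`.
    ... | x | refl = map₂ (map₁ len)
          (wrap (suc (toℕ y)) (x ∷ xs ++ [ y ]) nest (m≤n⇒m≤1+n (<⇒≤ x<y)) y+depth≡n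
            (x-within ∷ All.++⁺ (All.map widen within) (y-within ∷ []))
            (All.++⁺ (All.map x-precedes within) ((x<y , subst (Fin._< y) (sym πy≡x) x<y) ∷ []) ∷
             AllPairs.++⁺ ps ([] ∷ []) (All.map (λ w → precedes-y w ∷ []) within)))
      where
      y = π ⟨$⟩ʳ x
      πy≡x : π ⟨$⟩ʳ y ≡ x
      πy≡x = involutive x
      y+depth≡n : suc (toℕ y) + depth (toℕ x) ≡ n
      y+depth≡n = trans (cong (λ j → suc (j + depth (toℕ x))) (sym (σ-toℕ x))) (depth-sum (toℕ<n x))
      e≤y : e ≤ toℕ y
      e≤y = ≮⇒≥ λ y<e → <⇒≢ (+-mono-≤-< y<e d<k) (trans y+depth≡n (sym e+k≡n))
      x<y : toℕ x < toℕ y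
      x<y = <-≤-trans i<s (≤-trans s≤e e≤y)
      between : ∀ {z} → s ≤ z × z < e → toℕ x < z × z < toℕ y
      between (s≤z , z<e) = <-≤-trans i<s s≤z , <-≤-trans z<e e≤y
      widen : ∀ {z} → Within s e z → Within (toℕ x) (suc (toℕ y)) z
      widen (w , w′) = map <⇒≤ m<n⇒m<1+n (between w) , map <⇒≤ m<n⇒m<1+n (between w′)
      x-within : Within (toℕ x) (suc (toℕ y)) x
      x-within = (≤-refl , m<n⇒m<1+n x<y) , (<⇒≤ x<y , ≤-refl)
      y-within : Within (toℕ x) (suc (toℕ y)) y
      y-within rewrite πy≡x = (<⇒≤ x<y , ≤-refl) , (≤-refl , m<n⇒m<1+n x<y)
      x-precedes : ∀ {z} → Within s e z → Precedes x z
      x-precedes (w , w′) = proj₁ (between w) , proj₂ (between w′)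
      precedes-y : ∀ {z} → Within s e z → Precedes z y
      precedes-y (w , w′) = proj₂ (between w) , subst (Fin._< _) (sym πy≡x) (proj₁ (between w′))
      len : ∀ {l} → l ≡ m + m + suc (length (xs ++ [ y ])) → l ≡ suc m + suc m + length xs
      len {l} eq = trans eq (trans (cong (λ q → m + m + suc q) (length-++ xs)) (solve-len m (length xs)))
        where
        solve-len : ∀ m q → m + m + suc (q + 1) ≡ suc m + suc m + q
        solve-len = solve-∀

  nesting⇒decreasing : ∀ {m} t → t ≤ n → Nesting m t (n ∸ t) → DecreasingSubsequence π (2 * m)
  nesting⇒decreasing {m} t t≤n nest
    -- At the diagonal the window from `t` to `t` is empty, so the wrapping starts from the empty
    -- list.
    with ys , len , ps ← wrap t [] nest ≤-refl (m+[n∸m]≡n t≤n) [] []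
    = subst (DecreasingSubsequence π) (trans len (double m)) record
      { indices    = lookup ys
      ; increasing = λ i<j → proj₁ (AllPairs-lookup ps i<j)
      ; decreasing = λ i<j → proj₂ (AllPairs-lookup ps i<j)
      }
    where
    double : ∀ m → m + m + 0 ≡ 2 * m
    double = solve-∀

  private
    chain : ∀ m (a : ℕ → ℕ) → (∀ i → i < m → a i < a (suc i)) →
            (∀ i → i < m → σ (a (suc i)) < σ (a i)) → (∀ i → i ≤ m → a i < n) →
            Nesting (suc m) (suc (a m)) (suc (depth (a m)))
    chain zero    a _   _   _   = snoc (a 0) [] (n<1+n _) (n<1+n _)
    chain (suc m) a inc dec a<n = snoc (a (suc m))
      (nesting-widen (inc m (n<1+n m)) (∸-monoʳ-< (s<s (dec m (n<1+n m))) (σ-< (a<n m (n≤1+n m))))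
        (chain m a (λ i i<m → inc i (m<n⇒m<1+n i<m)) (λ i i<m → dec i (m<n⇒m<1+n i<m))
               (λ i i≤m → a<n i (m≤n⇒m≤1+n i≤m))))
      (n<1+n _) (n<1+n _)

    -- It suffices that the innermost arc lies above the diagonal, since the others enclose it. A
    -- cut right after its opening `a m` separates all openings from all closings.
    diagonal : ∀ m (a : ℕ → ℕ) → (∀ i → i < m → a i < a (suc i)) →
               (∀ i → i < m → σ (a (suc i)) < σ (a i)) → (∀ i → i ≤ m → a i < n) →
               a m < σ (a m) → ∃[ t ] t ≤ n × Nesting (suc m) t (n ∸ t)
    diagonal m a inc dec a<n above = suc (a m) , a<n m ≤-refl ,
      nesting-widen ≤-refl (∸-monoʳ-< (s<s above) (σ-< (a<n m ≤-refl))) (chain m a inc dec a<n)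

  -- The first half of the subsequence, or its second half read backwards through
  -- π, lies above the diagonal, depending on its middle element.
  decreasing⇒nesting : ∀ {j} m → 2 * m < j → DecreasingSubsequence π j →
                       ∃[ t ] t ≤ n × Nesting (suc m) t (n ∸ t)
  decreasing⇒nesting {j} m 2m<j D = case <-cmp (a m) (σ (a m)) of λ where
      (tri< above _ _) → diagonal m a
        (λ i i<m → a-inc (n<1+n i) (≤-<-trans i<m m<j))
        (λ i i<m → a-dec (n<1+n i) (≤-<-trans i<m m<j))
        (λ i i≤m → a<n (≤-<-trans i≤m m<j)) above
      (tri≈ _ fixed _) → ⊥-elim (σ-fixedPointFree (a<n m<j) (sym fixed))
      (tri> _ _ below) → diagonal m b
        (λ i i<m → a-dec (∸-monoʳ-< (n<1+n i) (≤-trans i<m m≤2m)) (2m∸<j i))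
        (λ i i<m → subst₂ _<_ (sym (σ-b (suc i))) (sym (σ-b i))
          (a-inc (∸-monoʳ-< (n<1+n i) (≤-trans i<m m≤2m)) (2m∸<j i)))
        (λ i _ → σ-< (a<n (2m∸<j i)))
        (subst₂ _<_ (cong (σ ∘ a) (sym middle)) (trans (cong a (sym middle)) (sym (σ-b m))) below)
    where
    open DecreasingSubsequence D
    a b : ℕ → ℕ
    a = extend (toℕ ∘ indices)
    b i = σ (a (2 * m ∸ i))
    m≤2m : m ≤ 2 * m
    m≤2m = m≤m+n m (m + 0)
    m<j : m < j
    m<j = ≤-<-trans m≤2m 2m<j
    2m∸<j : ∀ i → 2 * m ∸ i < j
    2m∸<j i = ≤-<-trans (m∸n≤m (2 * m) i) 2m<j
    middle : 2 * m ∸ m ≡ m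
    middle = trans (m+n∸m≡n m (m + 0)) (+-identityʳ m)
    a-index : ∀ {i} (i<j : i < j) → a i ≡ toℕ (indices (fromℕ< i<j))
    a-index = extend-fromℕ< (toℕ ∘ indices)
    a<n : ∀ {i} → i < j → a i < n
    a<n i<j = subst (_< n) (sym (a-index i<j)) (toℕ<n _)
    σ-b : ∀ i → σ (b i) ≡ a (2 * m ∸ i)
    σ-b i = σ-involutive (a<n (2m∸<j i))
    σ-a : ∀ {i} (i<j : i < j) → σ (a i) ≡ toℕ (π ⟨$⟩ʳ indices (fromℕ< i<j))
    σ-a i<j = trans (cong σ (a-index i<j)) (σ-toℕ _)
    ordered-indices : ∀ {i i′} (i<j : i < j) (i′<j : i′ < j) → i < i′ → fromℕ< i<j Fin.< fromℕ< i′<j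
    ordered-indices i<j i′<j = subst₂ _<_ (sym (toℕ-fromℕ< i<j)) (sym (toℕ-fromℕ< i′<j))
    a-inc : ∀ {i i′} → i < i′ → i′ < j → a i < a i′
    a-inc i<i′ i′<j = subst₂ _<_ (sym (a-index i<j)) (sym (a-index i′<j))
      (increasing (ordered-indices i<j i′<j i<i′))
      where i<j = <-trans i<i′ i′<j
    a-dec : ∀ {i i′} → i < i′ → i′ < j → σ (a i′) < σ (a i)
    a-dec i<i′ i′<j = subst₂ _<_ (sym (σ-a i′<j)) (sym (σ-a i<j))
      (decreasing (ordered-indices i<j i′<j i<i′))
      where i<j = <-trans i<i′ i′<j

  -- Let `t` maximise the first row and let `h` be that maximum. A nesting of `h` arcs yields length
  -- `2 * h`; anything longer would yield a nesting of `suc h` arcs and thus a longer first row.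
  maximal-decreasing : ∃[ t ] t ≤ n × IsMaxDecreasingLength π (2 * shape t 0)
  maximal-decreasing = attained (maximum-upTo (λ t → shape t 0) n)
    where
    attained : ∃[ t ] t ≤ n × (∀ {i} → i ≤ n → shape i 0 ≤ shape t 0) →
               ∃[ t ] t ≤ n × IsMaxDecreasingLength π (2 * shape t 0)
    attained (t , t≤n , max) = t , t≤n ,
      nesting⇒decreasing t t≤n (longest-nesting t (n ∸ t) t≤n) ,
      λ j D → ≮⇒≥ λ 2h<j → case decreasing⇒nesting (shape t 0) 2h<j D of λ where
        (t′ , t′≤n , nest) → <⇒≱ (nesting-bound t′≤n nest) (max t′≤n)

  height-bound : ∀ {p k} → IsMaxDecreasingLength π k → k ≤ 2 * p → ∀ t → t ≤ n → shape t 0 ≤ p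
  height-bound (_ , max) k≤2p t t≤n = *-cancelˡ-≤ 2
    (≤-trans (max _ (nesting⇒decreasing t t≤n (longest-nesting t (n ∸ t) t≤n))) k≤2p)

-- The two constructions are inverse to each other

module _ {n : ℕ} {Allowed : Shape → Set} (osc : Oscillating n Allowed) (π : Permutation′ n)
         (involutive : Involutive _≡_ (π ⟨$⟩ʳ_)) (fixedPointFree : ∀ i → π ⟨$⟩ʳ i ≢ i) where
  private
    module O = Oscillating osc
    module B = Bumping osc
    module G = FixedPointFree π involutive fixedPointFree

    shift₁ : ∀ s d k → suc (s + d + suc k) ≡ suc (suc (s + d) + k)
    shift₁ s d k = cong suc (+-suc (s + d) k)

    shift₂ : ∀ s d k → suc (s + suc d + k) ≡ suc (suc (s + d) + k)
    shift₂ s d k = cong (λ m → suc (m + k)) (+-suc s d)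

  Links : Set
  Links = ∀ i → B.Linked (toℕ i) (toℕ (π ⟨$⟩ʳ i))

  private
    s<n : ∀ {s} m → suc (s + m) ≡ n → s < n
    s<n {s} m e = subst (s <_) e (s≤s (m≤m+n s m))

    s<n′ : ∀ s d k → suc (suc (s + d) + k) ≡ n → s < n
    s<n′ s d k e = subst (s <_) e (s≤s (m≤n⇒m≤1+n (≤-trans (m≤m+n s d) (m≤m+n (s + d) k))))

    module _ (links : Links) where

      linked-σ : ∀ {i} → i < n → B.Linked i (G.σ i)
      linked-σ {i} i<n =
        subst₂ B.Linked e (trans (sym (G.σ-toℕ (fromℕ< i<n))) (cong G.σ e)) (links (fromℕ< i<n))
        where e = toℕ-fromℕ< i<n

      -- `d` counts from the diagonal and `k` from the outer side; the equation says that both name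
      -- the cell of `s` and `suc (s + d)`. As `s` has just one partner, the two diagrams mark the
      -- same cells.
      same-crossing : ∀ s d k → suc (suc (s + d) + k) ≡ n → B.crossed s d ≡ G.crossing s k
      same-crossing s d k eq with B.crossed s d in b | G.crossing s k in g
      ... | true  | true  = refl
      ... | false | false = refl
      ... | true  | false = trans (sym (dec-true (G.depth s ≟ k)
              (G.σ-unique eq (B.linked-functional (linked-σ s<) (inj₁ (d , refl , b)))))) g
        where s< = s<n′ s d k eq
      ... | false | true =
            case subst (B.Linked s) (G.depth-unique s< eq (G.crossing-depth s k g)) (linked-σ s<) of λ where
              (inj₁ (d′ , e , c)) → trans (sym b)
                (subst (B.Crossed s) (sym (+-cancelˡ-≡ s d d′ (suc-injective e))) c)
              (inj₂ (d′ , e , c)) → ⊥-elim (m≢1+m+n s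
                (trans e (cong suc (trans (cong suc (+-assoc s d d′)) (sym (+-suc s (d + d′)))))))
        where s< = s<n′ s d k eq

      -- Computed inwards: both diagrams are blank on the outer sides, and equal crossings and
      -- labels entering a cell give equal labels leaving it.
      same-row : ∀ s d k → suc (s + d + k) ≡ n → B.row s d ≡ G.row s k
      same-column : ∀ s d k → suc (s + d + k) ≡ n → B.column s d ≡ G.column s k

      forth-cell-agrees : ∀ s d k → suc (suc (s + d) + k) ≡ n →
        forth (G.row s k) (G.column s k) (G.crossing s k) ≡ (B.row s d , B.column (suc s) d)
      forth-cell-agrees s d k eq
        rewrite sym (same-row s (suc d) k (trans (shift₂ s d k) eq))
              | sym (same-column s (suc d) k (trans (shift₂ s d k) eq))
              | sym (same-crossing s d k eq) = cell-forth (B.cell s d)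

      same-row s d zero    eq = B.top-row s d (trans (cong suc (sym (+-identityʳ (s + d)))) eq)
      same-row s d (suc k) eq = sym (cong proj₁ (forth-cell-agrees s d k (trans (sym (shift₁ s d k)) eq)))

      same-column zero    d k eq = B.left-column d (s<n k eq)
      same-column (suc s) d k eq = sym (cong proj₂ (forth-cell-agrees s d k eq))

      same-moves : ∀ t → t < n → rise (O.move t) ≡ rise (G.move t) × fall (O.move t) ≡ fall (G.move t)
      same-moves t t<n =
        trans (same-row t 0 (n ∸ suc t) eq) (sym (proj₁ (G.move-labels t t<n))) ,
        trans (same-column t 0 (n ∸ suc t) eq) (sym (proj₂ (G.move-labels t t<n)))
        where
        eq : suc (t + 0 + (n ∸ suc t)) ≡ n
        eq = trans (cong (λ m → suc (m + (n ∸ suc t))) (+-identityʳ t)) (m+[n∸m]≡n t<n)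

  links⇒same-shape : Links → ∀ t → t ≤ n → O.shape t ≗ G.shape t
  links⇒same-shape links zero    _   r = O.starts r
  links⇒same-shape links (suc t) t<n r with er , ef ← same-moves links t t<n =
    +-cancelʳ-≡ (boxes (fall (O.move t)) r) _ _ (begin
      O.shape (suc t) r + boxes (fall (O.move t)) r  ≡⟨ O.moves t t<n r ⟨
      O.shape t r + boxes (rise (O.move t)) r
        ≡⟨ cong₂ (λ a u → a + boxes u r) (links⇒same-shape links t (<⇒≤ t<n) r) er ⟩
      G.shape t r + boxes (rise (G.move t)) r        ≡⟨ G.shape-moves t t<n r ⟩
      G.shape (suc t) r + boxes (fall (G.move t)) r  ≡⟨ cong (λ u → G.shape (suc t) r + boxes u r) ef ⟨
      G.shape (suc t) r + boxes (fall (O.move t)) r  ∎)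
    where open ≡-Reasoning

  module _ (same-shape : ∀ t → t ≤ n → O.shape t ≗ G.shape t) where
    private
      move-agrees : ∀ t → t < n → O.move t ≡ G.move t
      move-agrees t t<n = move-unique (O.moves t t<n) λ r → begin
        O.shape t r + boxes (rise (G.move t)) r        ≡⟨ cong (_+ _) (same-shape t (<⇒≤ t<n) r) ⟩
        G.shape t r + boxes (rise (G.move t)) r        ≡⟨ G.shape-moves t t<n r ⟩
        G.shape (suc t) r + boxes (fall (G.move t)) r  ≡⟨ cong (_+ _) (same-shape (suc t) t<n r) ⟨
        O.shape (suc t) r + boxes (fall (G.move t)) r  ∎
        where open ≡-Reasoning

      -- Computed outwards: both diagrams have the same moves on the diagonal, and `back` then fixes
      -- the labels and the crossing of each further cell.
      row-agrees : ∀ d s k → suc (s + d + k) ≡ n → B.row s d ≡ G.row s k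
      column-agrees : ∀ d s k → suc (s + d + k) ≡ n → B.column s d ≡ G.column s k

      start-agrees : ∀ s k → suc (s + 0 + k) ≡ n →
                     rise (O.move s) ≡ G.row s k × fall (O.move s) ≡ G.column s k
      start-agrees s k eq =
        trans (cong rise (move-agrees s s<)) (trans (proj₁ (G.move-labels s s<)) (cong (G.row s) k≡)) ,
        trans (cong fall (move-agrees s s<)) (trans (proj₂ (G.move-labels s s<)) (cong (G.column s) k≡))
        where
        eq′ : suc (s + k) ≡ n
        eq′ = trans (cong (λ m → suc (m + k)) (sym (+-identityʳ s))) eq
        s< = s<n k eq′
        k≡ : n ∸ suc s ≡ k
        k≡ = trans (cong (_∸ suc s) (sym eq′)) (m+n∸m≡n (suc s) k)

      back-cell-agrees : ∀ d s k → suc (suc (s + d) + k) ≡ n →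
        back (B.row s d) (B.column (suc s) d) ≡ (G.row s k , G.column s k , G.crossing s k)
      back-cell-agrees d s k eq
        rewrite row-agrees d s (suc k) (trans (shift₁ s d k) eq)
              | column-agrees d (suc s) k eq
        = cell-back (G.cell s k (s<n′ s d k eq))

      row-agrees zero    s k eq = proj₁ (start-agrees s k eq)
      row-agrees (suc d) s k eq = cong proj₁ (back-cell-agrees d s k (trans (sym (shift₂ s d k)) eq))

      column-agrees zero    s k eq = proj₂ (start-agrees s k eq)
      column-agrees (suc d) s k eq = cong (proj₁ ∘ proj₂) (back-cell-agrees d s k (trans (sym (shift₂ s d k)) eq))

      arc⇒σ : ∀ {s t} → t < n → B.Arc s t → G.σ s ≡ t
      arc⇒σ {s} {t} t<n (d , refl , c) = G.depth-unique (<-trans (s≤s (m≤m+n s d)) t<n) eq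
        (G.crossing-depth s k (trans (sym (cong (proj₂ ∘ proj₂) (back-cell-agrees d s k eq))) c))
        where
        k = n ∸ suc t
        eq : suc (t + k) ≡ n
        eq = m+[n∸m]≡n t<n

    linked⇒σ : ∀ {i j} → i < n → j < n → B.Linked i j → G.σ i ≡ j
    linked⇒σ i<n j<n (inj₁ a) = arc⇒σ j<n a
    linked⇒σ i<n j<n (inj₂ a) = trans (cong G.σ (sym (arc⇒σ i<n a))) (G.σ-involutive j<n)

-- The bijection between oscillating tableaux and involutions

FirstRowAtMost : ℕ → Shape → Set
FirstRowAtMost p lam = lam 0 ≤ p

module _ (N p : ℕ) where
  private
    n = 2 * N

    module Matching (osc : Oscillating n (FirstRowAtMost p)) where
      open Bumping osc

      partner : Fin n → Fin n
      partner i = fromℕ< (proj₁ (proj₂ (linked-total (toℕ i) (toℕ<n i))))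

      partner-linked : ∀ i → Linked (toℕ i) (toℕ (partner i))
      partner-linked i =
        subst (Linked (toℕ i)) (sym (toℕ-fromℕ< _)) (proj₂ (proj₂ (linked-total (toℕ i) (toℕ<n i))))

      partner-involutive : Involutive _≡_ partner
      partner-involutive i = toℕ-injective
        (linked-functional (partner-linked (partner i)) (linked-sym (partner-linked i)))

      partner-≢ : ∀ i → partner i ≢ i
      partner-≢ i e = linked-irreflexive (subst (Linked (toℕ i) ∘ toℕ) e (partner-linked i))

      pairing : Permutation′ n
      pairing = permutation partner partner partner-involutive partner-involutive

      same-shape : ∀ t → t ≤ n →
        Oscillating.shape osc t ≗ FixedPointFree.shape pairing partner-involutive partner-≢ t
      same-shape = links⇒same-shape osc pairing partner-involutive partner-≢ partner-linked

      open FixedPointFree pairing partner-involutive partner-≢ using (shape; maximal-decreasing)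

      involution : BoundedInvolution N p
      involution = record
        { permutation    = pairing
        ; involutive     = partner-involutive
        ; fixedPointFree = partner-≢
        ; maxDecreasing  = case maximal-decreasing of λ where
            (t , t≤n , max) → 2 * shape t 0 , max ,
              *-monoʳ-≤ 2 (subst (_≤ p) (same-shape t t≤n 0) (Oscillating.allowed osc t t≤n))
        }

    module Inverse (inv : BoundedInvolution N p) where
      open BoundedInvolution inv renaming (permutation to π)
      open FixedPointFree π involutive fixedPointFree public

      osc : Oscillating n (FirstRowAtMost p)
      osc = oscillation (case maxDecreasing of λ where (k , max , k≤2p) → height-bound max k≤2p)

      -- Serves twice: for surjectivity, and, applied to the involution of an equal tableau, for
      -- compatibility with equality.
      partner-agrees : ∀ (z : Oscillating n (FirstRowAtMost p)) →
                       (∀ t → t ≤ n → Oscillating.shape z t ≗ shape t) →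
                       ∀ i → Matching.partner z i ≡ π ⟨$⟩ʳ i
      partner-agrees z z≈ i = toℕ-injective (trans
        (sym (linked⇒σ z π involutive fixedPointFree z≈ (toℕ<n i) (toℕ<n _) (Matching.partner-linked z i)))
        (σ-toℕ i))

  oscillations⤖involutions : Bijection (oscillating n (FirstRowAtMost p)) (boundedInvolutions N p)
  oscillations⤖involutions = record
    { to        = involution
    ; cong      = λ {o} {o′} o≈o′ → Inverse.partner-agrees (involution o′) o
                    λ t t≤n r → trans (o≈o′ t t≤n r) (same-shape o′ t t≤n r)
    -- The links of `o′` are carried over to the pairing of `o`, so both tableaux are the diagonal
    -- of one growth diagram.
    ; bijective = (λ {o} {o′} e t t≤n r → trans (same-shape o t t≤n r) (sym
                    (links⇒same-shape o′ (pairing o) (partner-involutive o) (partner-≢ o)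
                      (λ i → subst (λ j → Bumping.Linked o′ (toℕ i) (toℕ j)) (sym (e i)) (partner-linked o′ i))
                      t t≤n r))) ,
                  λ inv → Inverse.osc inv , λ {z} → Inverse.partner-agrees inv z
    }
    where open Matching

-- Walker configurations as oscillating tableaux

RowsAtMost : ℕ → Shape → Set
RowsAtMost m lam = ∀ r → m ≤ r → lam r ≡ 0

Antitone-≤ : ∀ {lam} → Antitone lam → ∀ {r r′} → r ≤ r′ → lam r′ ≤ lam r
Antitone-≤ {lam} anti {r} r≤r′ = descend (≤⇒≤′ r≤r′)
  where
  descend : ∀ {r′} → r ≤′ r′ → lam r′ ≤ lam r
  descend (≤′-reflexive refl) = ≤-refl
  descend {suc r′} (≤′-step le) = ≤-trans (anti r′) (descend le)

extend-cong : ∀ {n} {f g : Fin n → ℕ} → f ≗ g → extend f ≗ extend g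
extend-cong {zero}  f≗g _       = refl
extend-cong {suc n} f≗g zero    = f≗g Fin.zero
extend-cong {suc n} f≗g (suc i) = extend-cong (f≗g ∘ Fin.suc) i

extend-beyond : ∀ {n} (f : Fin n → ℕ) {i} → n ≤ i → extend f i ≡ 0
extend-beyond {zero}  f n≤i       = refl
extend-beyond {suc n} f (s≤s n≤i) = extend-beyond (f ∘ Fin.suc) n≤i

module _ {m : ℕ} where

  -- The walkers are numbered from left to right, whereas row 0 is the displacement
  -- of the right-most one.
  rowOf : Fin m → ℕ
  rowOf i = toℕ (opposite i)

  walkerOf : ∀ {r} → r < m → Fin m
  walkerOf r<m = opposite (fromℕ< r<m)

  rowOf-walkerOf : ∀ {r} (r<m : r < m) → rowOf (walkerOf r<m) ≡ r
  rowOf-walkerOf r<m = trans (cong toℕ (opposite-involutive (fromℕ< r<m))) (toℕ-fromℕ< r<m)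

  rowOf-sum : ∀ i → suc (toℕ i + rowOf i) ≡ m
  rowOf-sum i = trans (cong (λ j → suc (toℕ i + j)) (opposite-prop i)) (m+[n∸m]≡n (toℕ<n i))

  rowOf-injective : ∀ {i j} → rowOf i ≡ rowOf j → i ≡ j
  rowOf-injective {i} {j} e = toℕ-injective (+-cancelʳ-≡ (rowOf i) _ _ (suc-injective
    (trans (rowOf-sum i) (trans (sym (rowOf-sum j)) (cong (λ r → suc (toℕ j + r)) (sym e))))))

  onRows : {P : ℕ → Set} → (∀ i → P (rowOf i)) → (∀ {r} → m ≤ r → P r) → ∀ r → P r
  onRows {P} p q r with r <? m
  ... | yes r<m = subst P (rowOf-walkerOf r<m) (p (walkerOf r<m))
  ... | no r≮m  = q (≮⇒≥ r≮m)

  place : Shape → Position m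
  place lam i = ℤ.+ suc (toℕ i + lam (rowOf i))

  Located : Position m → Shape → Set
  Located l lam = l ≗ place lam

  -- Here `i` numbers a row, so `suc (rowOf i)` is the packed site of the walker `opposite i`.
  rows : Position m → Shape
  rows l = extend λ i → ∣ l (opposite i) ∣ ∸ suc (rowOf i)

  rows-cong : ∀ {l l′} → l ≗ l′ → rows l ≗ rows l′
  rows-cong l≗l′ = extend-cong λ i → cong (λ z → ∣ z ∣ ∸ suc (rowOf i)) (l≗l′ (opposite i))

  rows-atMost : ∀ l → RowsAtMost m (rows l)
  rows-atMost l r m≤r = extend-beyond _ m≤r

  rows-row : ∀ l i → rows l (rowOf i) ≡ ∣ l i ∣ ∸ suc (toℕ i)
  rows-row l i = trans (extend-toℕ _ (opposite i))
    (cong (λ j → ∣ l j ∣ ∸ suc (toℕ j)) (opposite-involutive i))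

  place-rows : ∀ {l lam} → RowsAtMost m lam → Located l lam → rows l ≗ lam
  place-rows {l} {lam} atMost located = onRows
    (λ i → trans (rows-row l i) (trans (cong (λ z → ∣ z ∣ ∸ suc (toℕ i)) (located i))
      (m+n∸m≡n (suc (toℕ i)) _)))
    (λ m≤r → trans (rows-atMost l _ m≤r) (sym (atMost _ m≤r)))

  place-cong : ∀ {lam lam′} → lam ≗ lam′ → place lam ≗ place lam′
  place-cong e i = cong (λ j → ℤ.+ suc (toℕ i + j)) (e (rowOf i))

  place-confined : ∀ lam → Confined (place lam)
  place-confined lam i = +≤+ (s≤s z≤n)

  place-ordered : ∀ {lam} → Antitone lam → place lam Preserves Fin._<_ ⟶ ℤ._<_
  place-ordered {lam} anti {i} {j} i<j = +<+ (s≤s (+-mono-<-≤ i<j (Antitone-≤ anti (<⇒≤ rows<))))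
    where
    rows< : rowOf j < rowOf i
    rows< = ≰⇒> λ le → <⇒≢ (+-mono-<-≤ i<j le) (suc-injective (trans (rowOf-sum i) (sym (rowOf-sum j))))

  -- Packed neighbours are one site apart, so a strict order of positions amounts to a weak order of
  -- displacements.
  Located-antitone : ∀ {l lam} → l Preserves Fin._<_ ⟶ ℤ._<_ → RowsAtMost m lam →
                     Located l lam → Antitone lam
  Located-antitone {l} {lam} ordered atMost located r with suc r <? m
  ... | no r≮m = ≤-trans (≤-reflexive (atMost (suc r) (≮⇒≥ r≮m))) z≤n
  ... | yes r<m = ≤-pred (+-cancelˡ-< (toℕ i) _ _ (subst₂ _<_ refl (sym (+-suc (toℕ i) _)) (≤-pred lt)))
    where
    i = walkerOf r<m
    r<m′ = <-trans (n<1+n r) r<m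
    j = walkerOf r<m′
    toℕj≡ : toℕ j ≡ suc (toℕ i)
    toℕj≡ = +-cancelʳ-≡ r _ _ (suc-injective (begin
      suc (toℕ j + r)       ≡⟨ cong (λ q → suc (toℕ j + q)) (rowOf-walkerOf r<m′) ⟨
      suc (toℕ j + rowOf j) ≡⟨ trans (rowOf-sum j) (sym (rowOf-sum i)) ⟩
      suc (toℕ i + rowOf i) ≡⟨ cong (λ q → suc (toℕ i + q)) (rowOf-walkerOf r<m) ⟩
      suc (toℕ i + suc r)   ≡⟨ cong suc (+-suc (toℕ i) r) ⟩
      suc (suc (toℕ i) + r) ∎))
      where open ≡-Reasoning
    lt : suc (toℕ i + lam (suc r)) < suc (suc (toℕ i) + lam r)
    lt = ℤ.drop‿+<+ (subst₂ ℤ._<_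
      (trans (located i) (cong (λ q → ℤ.+ suc (toℕ i + lam q)) (rowOf-walkerOf r<m)))
      (trans (located j) (cong₂ (λ k q → ℤ.+ suc (k + lam q)) toℕj≡ (rowOf-walkerOf r<m′)))
      (ordered (subst (toℕ i <_) (sym toℕj≡) (n<1+n (toℕ i)))))

  -- Walker `i` has `toℕ i` walkers to its left on distinct sites from 1 on, so it never gets left
  -- of its packed site and no subtraction is truncated.
  Located-rows : ∀ {l} → Confined l → l Preserves Fin._<_ ⟶ ℤ._<_ → Located l (rows l)
  Located-rows {l} confined ordered i = begin
    l i                                          ≡⟨ nonNegative i ⟨
    ℤ.+ ∣ l i ∣                                    ≡⟨ cong ℤ.+_ (m+[n∸m]≡n (≥-start i)) ⟨
    ℤ.+ suc (toℕ i + (∣ l i ∣ ∸ suc (toℕ i)))      ≡⟨ cong (λ q → ℤ.+ suc (toℕ i + q)) (rows-row l i) ⟨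
    place (rows l) i                             ∎
    where
    open ≡-Reasoning
    nonNegative : ∀ i → ℤ.+ ∣ l i ∣ ≡ l i
    nonNegative i = ℤ.0≤i⇒+∣i∣≡i (ℤ.≤-trans (+≤+ z≤n) (confined i))
    height-ordered : ∀ {i j} → i Fin.< j → ∣ l i ∣ < ∣ l j ∣
    height-ordered i<j = ℤ.drop‿+<+ (subst₂ ℤ._<_ (sym (nonNegative _)) (sym (nonNegative _)) (ordered i<j))
    ≥-start : ∀ i → suc (toℕ i) ≤ ∣ l i ∣
    ≥-start i = go (toℕ i) refl
      where
      go : ∀ k {i} → toℕ i ≡ k → suc k ≤ ∣ l i ∣
      go zero    {i} _ = ℤ.drop‿+≤+ (subst (1ℤ ℤ.≤_) (sym (nonNegative i)) (confined i))
      go (suc k) {i} e = ≤-<-trans (go k (toℕ-fromℕ< k<m))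
        (height-ordered (subst₂ _<_ (sym (toℕ-fromℕ< k<m)) (sym e) (n<1+n k)))
        where k<m = <-trans (n<1+n k) (subst (_< m) e (toℕ<n i))

  private
    place-injective : ∀ {a b} (i : Fin m) → ℤ.+ suc (toℕ i + a) ≡ ℤ.+ suc (toℕ i + b) → a ≡ b
    place-injective i e = +-cancelˡ-≡ (toℕ i) _ _ (suc-injective (ℤ.+-injective e))

    -- Only steps to the right are treated; a step to the left is one to the right with the two
    -- times exchanged.
    ascend : ∀ {l l′ lam lam′} i → Located l lam → Located l′ lam′ →
             RowsAtMost m lam → RowsAtMost m lam′ →
             l′ i ≡ l i ℤ.+ 1ℤ → (∀ j → j ≢ i → l′ j ≡ l j) → Moves (up (rowOf i)) lam lam′
    ascend {l} {l′} {lam} {lam′} i loc loc′ atMost atMost′ moved fixed = onRows onWalker beyond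
      where
      onWalker : ∀ j → lam (rowOf j) + indicator (rowOf i) (rowOf j) ≡ lam′ (rowOf j) + 0
      onWalker j with j Fin.≟ i
      ... | yes refl rewrite indicator-refl (rowOf i) | +-identityʳ (lam′ (rowOf i)) =
            sym (place-injective i (trans (sym (loc′ i)) (trans moved (trans (cong (ℤ._+ 1ℤ) (loc i))
              (cong (ℤ.+_ ∘ suc) (+-assoc (toℕ i) _ 1))))))
      ... | no j≢i rewrite indicator-≢ (λ e → j≢i (sym (rowOf-injective {i} {j} e))) =
            cong (_+ 0) (place-injective j (trans (sym (loc j)) (trans (sym (fixed j j≢i)) (loc′ j))))
      beyond : ∀ {r} → m ≤ r → lam r + indicator (rowOf i) r ≡ lam′ r + 0
      beyond {r} m≤r rewrite atMost r m≤r | atMost′ r m≤r = indicator-≢ (<⇒≢ (<-≤-trans (toℕ<n (opposite i)) m≤r))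

    reverse : ∀ {r lam lam′} → Moves (up r) lam lam′ → Moves (down r) lam′ lam
    reverse s k = sym (s k)

    undo : ∀ {x y} → x ≡ y ℤ.- 1ℤ → y ≡ x ℤ.+ 1ℤ
    undo {x} {y} refl = sym (trans (ℤ.+-assoc y (ℤ.- 1ℤ) 1ℤ) (ℤ.+-identityʳ y))

  step⇒move : ∀ {l l′ lam lam′} → Located l lam → Located l′ lam′ →
              RowsAtMost m lam → RowsAtMost m lam′ → Step l l′ → ∃[ μ ] Moves μ lam lam′
  step⇒move loc loc′ atMost atMost′ (i , inj₁ right , fixed) =
    up (rowOf i) , ascend i loc loc′ atMost atMost′ right fixed
  step⇒move {lam = lam} {lam′} loc loc′ atMost atMost′ (i , inj₂ left , fixed) =
    down (rowOf i) , reverse {rowOf i} {lam′} {lam}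
      (ascend i loc′ loc atMost′ atMost (undo left) (λ j j≢i → sym (fixed j j≢i)))

  private
    ascent : ∀ {r lam lam′} → Moves (up r) lam lam′ → RowsAtMost m lam′ →
             ∃[ i ] place lam′ i ≡ place lam i ℤ.+ 1ℤ × (∀ j → j ≢ i → place lam′ j ≡ place lam j)
    ascent {r} {lam} {lam′} s atMost′ = i , moved , fixed
      where
      lam′≡ : ∀ k → lam′ k ≡ lam k + indicator r k
      lam′≡ k = trans (sym (+-identityʳ (lam′ k))) (sym (s k))
      -- A box in row `m` or beyond would contradict the bound on the rows of `lam′`.
      r<m : r < m
      r<m = ≰⇒> λ m≤r → 0≢1+n (trans (sym (atMost′ r m≤r)) (trans (lam′≡ r)
        (trans (cong (λ q → lam r + q) (indicator-refl r)) (+-comm (lam r) 1))))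
      i = walkerOf r<m
      moved : place lam′ i ≡ place lam i ℤ.+ 1ℤ
      moved = cong (λ q → ℤ.+ suc q) (trans
        (cong (λ q → toℕ i + q) (trans (lam′≡ (rowOf i)) (cong (λ q → lam (rowOf i) + q)
          (trans (cong (indicator r) (rowOf-walkerOf r<m)) (indicator-refl r)))))
        (sym (+-assoc (toℕ i) (lam (rowOf i)) 1)))
      fixed : ∀ j → j ≢ i → place lam′ j ≡ place lam j
      fixed j j≢i = cong (λ q → ℤ.+ suc (toℕ j + q)) (trans (lam′≡ (rowOf j)) (trans
        (cong (λ q → lam (rowOf j) + q) (indicator-≢ λ e →
          j≢i (rowOf-injective {j} {i} (trans (sym e) (sym (rowOf-walkerOf r<m))))))
        (+-identityʳ (lam (rowOf j)))))

  move⇒step : ∀ {lam lam′} μ → Moves μ lam lam′ → RowsAtMost m lam → RowsAtMost m lam′ →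
              Step (place lam) (place lam′)
  move⇒step {lam} {lam′} (up r) s atMost atMost′
    with i , moved , fixed ← ascent {r} {lam} {lam′} s atMost′ = i , inj₁ moved , fixed
  move⇒step {lam} {lam′} (down r) s atMost atMost′
    with i , moved , fixed ← ascent {r} {lam′} {lam} (λ k → sym (s k)) atMost
    = i , inj₂ (redo moved) , λ j j≢i → sym (fixed j j≢i)
    where
    redo : ∀ {x y} → y ≡ x ℤ.+ 1ℤ → x ≡ y ℤ.- 1ℤ
    redo {x} refl = sym (trans (ℤ.+-assoc x 1ℤ (ℤ.- 1ℤ)) (ℤ.+-identityʳ x))

oscillatingFrom : ∀ {n A} (shape : ℕ → Shape) → (∀ r → shape 0 r ≡ 0) → (∀ r → shape n r ≡ 0) →
  (∀ t → t ≤ n → Antitone (shape t)) →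
  (∀ t → t < n → ∃[ μ ] Moves μ (shape t) (shape (suc t))) →
  (∀ t → t ≤ n → A (shape t)) → Oscillating n A
oscillatingFrom {n} shape starts ends antitone moves allowed = record
  { shape = shape ; move = move ; starts = starts ; ends = ends
  ; antitone = antitone ; moves = move-moves ; allowed = allowed }
  where
  move : ℕ → Move
  move t with t <? n
  ... | yes t<n = proj₁ (moves t t<n)
  -- An arbitrary value for the times from `n` on.
  ... | no _    = up 0
  move-moves : ∀ t → t < n → Moves (move t) (shape t) (shape (suc t))
  move-moves t t<n with t <? n
  ... | yes t<n = proj₂ (moves t t<n)
  ... | no t≮n  = ⊥-elim (t≮n t<n)

restrict : ∀ {n A B} (osc : Oscillating n A) → (∀ t → t ≤ n → B (Oscillating.shape osc t)) → Oscillating n B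
restrict osc allowed = record
  { shape = shape ; move = move ; starts = starts ; ends = ends
  ; antitone = antitone ; moves = moves ; allowed = allowed }
  where open Oscillating osc hiding (allowed)

module _ (N m : ℕ) where
  private
    n = 2 * N

  module Walk (walk : FirstClass N m) where
    open FirstClass walk

    rowsAt : Fin (suc n) → Shape
    rowsAt t = rows (positions configuration t)

    located : ∀ t → Located (positions configuration t) (rowsAt t)
    located t = Located-rows (confined configuration t) (ordered configuration t)

    rowsAt-atMost : ∀ t → RowsAtMost m (rowsAt t)
    rowsAt-atMost t = rows-atMost (positions configuration t)

    rowsAt-antitone : ∀ t → Antitone (rowsAt t)
    rowsAt-antitone t = Located-antitone {l = positions configuration t}
      (ordered configuration t) (rowsAt-atMost t) (located t)

    shape : ℕ → Shape
    shape t r = extend (λ t → rowsAt t r) t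

    shape-toℕ : ∀ t → shape (toℕ t) ≗ rowsAt t
    shape-toℕ t r = extend-toℕ (λ t → rowsAt t r) t

    shape-at : ∀ {t} (t≤n : t ≤ n) → shape t ≗ rowsAt (fromℕ< (s≤s t≤n))
    shape-at t≤n r = extend-fromℕ< (λ t → rowsAt t r) (s≤s t≤n)

    initially-empty : ∀ r → rowsAt Fin.zero r ≡ 0
    initially-empty = place-rows (λ _ _ → refl) λ i →
      trans (startsPacked i) (cong (λ q → ℤ.+ suc q) (sym (+-identityʳ (toℕ i))))

    finally-empty : ∀ r → rowsAt (fromℕ n) r ≡ 0
    finally-empty r = trans (rows-cong returns r) (initially-empty r)

    moved : ∀ t → ∃[ μ ] Moves μ (rowsAt (inject₁ t)) (rowsAt (Fin.suc t))
    moved t = step⇒move {l = positions configuration (inject₁ t)} {l′ = positions configuration (Fin.suc t)}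
                (located (inject₁ t)) (located (Fin.suc t)) (rowsAt-atMost (inject₁ t)) (rowsAt-atMost (Fin.suc t))
                (steps configuration t)

    shape-moves : ∀ t → t < n → ∃[ μ ] Moves μ (shape t) (shape (suc t))
    shape-moves t t<n = μ , λ r → subst₂ (λ a b → a + boxes (rise μ) r ≡ b + boxes (fall μ) r)
      (trans (sym (shape-toℕ (inject₁ τ) r)) (cong (λ u → shape u r) (trans (toℕ-inject₁ τ) τ≡t)))
      (trans (sym (shape-toℕ (Fin.suc τ) r)) (cong (λ u → shape (suc u) r) τ≡t))
      (proj₂ (moved τ) r)
      where
      τ = fromℕ< t<n
      τ≡t = toℕ-fromℕ< t<n
      μ = proj₁ (moved τ)

    oscillation : Oscillating n (RowsAtMost m)
    oscillation = oscillatingFrom shape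
      (λ r → trans (shape-toℕ Fin.zero r) (initially-empty r))
      (λ r → trans (cong (λ t → shape t r) (sym (toℕ-fromℕ n)))
        (trans (shape-toℕ (fromℕ n) r) (finally-empty r)))
      (λ t t≤n → Antitone-resp-≗ (λ r → sym (shape-at t≤n r)) (rowsAt-antitone (fromℕ< (s≤s t≤n))))
      shape-moves
      (λ t t≤n r m≤r → trans (shape-at t≤n r) (rowsAt-atMost (fromℕ< (s≤s t≤n)) r m≤r))

  module Unwalk (osc : Oscillating n (RowsAtMost m)) where
    open Oscillating osc

    at : ∀ (t : Fin (suc n)) → toℕ t ≤ n
    at t = ≤-pred (toℕ<n t)

    walk : FirstClass N m
    walk = record
      { configuration = record
        { positions = λ t → place (shape (toℕ t))
        ; confined  = λ t → place-confined (shape (toℕ t))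
        ; ordered   = λ t → place-ordered (antitone (toℕ t) (at t))
        ; steps     = λ t → subst (λ s → Step (place (shape s)) (place (shape (suc (toℕ t))))) (sym (toℕ-inject₁ t))
                        (move⇒step (move (toℕ t)) (moves (toℕ t) (toℕ<n t))
                          (allowed (toℕ t) (<⇒≤ (toℕ<n t))) (allowed (suc (toℕ t)) (toℕ<n t)))
        }
      ; startsPacked  = empty starts
      ; returns       = λ i → trans
          (empty (λ r → trans (cong (λ t → shape t r) (toℕ-fromℕ n)) (ends r)) i) (sym (empty starts i))
      }
      where
      empty : ∀ {lam} → (∀ r → lam r ≡ 0) → ∀ (i : Fin m) → place lam i ≡ ℤ.+ suc (toℕ i)
      empty {lam} lam≡0 i =
        cong (λ q → ℤ.+ suc q) (trans (cong (λ q → toℕ i + q) (lam≡0 _)) (+-identityʳ (toℕ i)))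

  walks⤖oscillations : Bijection (firstClass N m) (oscillating n (RowsAtMost m))
  walks⤖oscillations = record
    { to        = Walk.oscillation
    ; cong      = λ e t _ r → extend-cong (λ t → rows-cong (e t) r) t
    ; bijective =
        (λ {c} {c′} e t i → let module C = Walk c ; module C′ = Walk c′ in
          trans (C.located t i) (trans
            (place-cong (λ r → trans (sym (C.shape-toℕ t r))
              (trans (e (toℕ t) (≤-pred (toℕ<n t)) r) (C′.shape-toℕ t r))) i)
            (sym (C′.located t i)))) ,
        λ osc → Unwalk.walk osc , λ {z} e t t≤n r → trans (Walk.shape-at z t≤n r) (place-rows
          (Oscillating.allowed osc t t≤n)
          (λ i → trans (e (fromℕ< (s≤s t≤n)) i)
            (cong (λ u → place (Oscillating.shape osc u) i) (toℕ-fromℕ< (s≤s t≤n)))) r)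
    }

-- Time reversal and the number of rows

flip : Move → Move
flip (up r)   = down r
flip (down r) = up r

Moves-flip : ∀ μ {lam lam′} → Moves μ lam lam′ → Moves (flip μ) lam′ lam
Moves-flip (up r)   s k = sym (s k)
Moves-flip (down r) s k = sym (s k)

module _ (n : ℕ) (shape : ℕ → Shape) (starts : ∀ r → shape 0 r ≡ 0)
         (antitone : ∀ t → t ≤ n → Antitone (shape t))
         (moves : ∀ t → t < n → ∃[ μ ] Moves μ (shape t) (shape (suc t))) where

  -- One step cannot add a box to both row `r` and row `suc r`, which were empty. The row it misses
  -- stays empty; if that is row `r`, the order of the rows empties row `suc r` as well.
  rows-at-time : ∀ t → t ≤ n → RowsAtMost t (shape t)
  rows-at-time zero    _   r       _         = starts r
  rows-at-time (suc t) t<n (suc r) (s≤s t≤r) = case boxes-apart (rise μ) of λ where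
      (inj₁ e) → n≤0⇒n≡0 (≤-trans (antitone (suc t) t<n r) (grown t≤r e))
      (inj₂ e) → n≤0⇒n≡0 (grown (m≤n⇒m≤1+n t≤r) e)
    where
    μ = proj₁ (moves t t<n)
    boxes-apart : ∀ u → boxes u r ≡ 0 ⊎ boxes u (suc r) ≡ 0
    boxes-apart nothing  = inj₁ refl
    boxes-apart (just q) with q ≟ r
    ... | yes refl = inj₂ (indicator-≢ (≢-sym (1+n≢n {q})))
    ... | no q≢r   = inj₁ (indicator-≢ q≢r)
    grown : ∀ {k} → t ≤ k → boxes (rise μ) k ≡ 0 → shape (suc t) k ≤ 0
    grown {k} t≤k e = begin
      shape (suc t) k                     ≤⟨ m≤m+n _ _ ⟩
      shape (suc t) k + boxes (fall μ) k  ≡⟨ proj₂ (moves t t<n) k ⟨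
      shape t k + boxes (rise μ) k        ≡⟨ cong₂ _+_ (rows-at-time t (<⇒≤ t<n) k t≤k) e ⟩
      0                                   ∎
      where open ≤-Reasoning

-- The shape at time t can only have as many rows as there are steps before t,
-- and, by time reversal, as many as there are steps after t.
rows-bounded : ∀ {N A} (osc : Oscillating (2 * N) A) →
               ∀ t → t ≤ 2 * N → RowsAtMost N (Oscillating.shape osc t)
rows-bounded {N} osc t t≤n r N≤r with ≤-total t N
... | inj₁ t≤N = rows-at-time n shape starts antitone (λ t t<n → move t , moves t t<n) t t≤n r (≤-trans t≤N N≤r)
  where
  open Oscillating osc
  n = 2 * N
... | inj₂ N≤t = subst (λ u → shape u r ≡ 0) (m∸[m∸n]≡n t≤n)
    (rows-at-time n (λ u → shape (n ∸ u)) ends (λ u _ → antitone (n ∸ u) (m∸n≤m n u)) reversed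
      (n ∸ t) (m∸n≤m n t) r (≤-trans late N≤r))
  where
  open Oscillating osc
  n = 2 * N
  late : n ∸ t ≤ N
  late = m≤n+o⇒m∸n≤o n t (≤-trans (≤-reflexive (cong (N +_) (+-identityʳ N))) (+-monoˡ-≤ N N≤t))
  reversed : ∀ u → u < n → ∃[ μ ] Moves μ (shape (n ∸ u)) (shape (n ∸ suc u))
  reversed u u<n = flip (move v) ,
    subst (λ w → Moves (flip (move v)) (shape w) (shape v)) (sym (+-∸-assoc 1 u<n))
    (Moves-flip (move v) {shape v} {shape (suc v)} (moves v (subst (_≤ n) (+-∸-assoc 1 u<n) (m∸n≤m n u))))
    where v = n ∸ suc u

-- Conjugation of partitions

-- The box `(r , c)` lies in one shape just when `(c , r)` lies in the other. Stated as a relation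
-- it is symmetric, and each shape determines the other.
Conjugate : Shape → Shape → Set
Conjugate lam lam* = ∀ r c → (c < lam r → r < lam* c) × (r < lam* c → c < lam r)

private
  ≤-from-< : ∀ {a b} → (∀ r → r < a → r < b) → a ≤ b
  ≤-from-< {zero}  f = z≤n
  ≤-from-< {suc a} f = f a (n<1+n a)

Conjugate-sym : ∀ {lam lam*} → Conjugate lam lam* → Conjugate lam* lam
Conjugate-sym conj c r = swap (conj r c)

Conjugate-cong : ∀ {lam lam* μ μ*} → Conjugate lam lam* → Conjugate μ μ* → lam ≗ μ → lam* ≗ μ*
Conjugate-cong conj conj′ e c = ≤-antisym
  (≤-from-< λ r r< → proj₁ (conj′ r c) (subst (c <_) (e r) (proj₂ (conj r c) r<)))
  (≤-from-< λ r r< → proj₁ (conj r c) (subst (c <_) (sym (e r)) (proj₂ (conj′ r c) r<)))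

Conjugate-antitone : ∀ {lam lam*} → Conjugate lam lam* → Antitone lam*
Conjugate-antitone conj c = ≤-from-< λ r r< →
  proj₁ (conj r c) (<-trans (n<1+n c) (proj₂ (conj r (suc c)) r<))

Conjugate-empty : ∀ {lam lam*} → Conjugate lam lam* → (∀ r → lam r ≡ 0) → ∀ c → lam* c ≡ 0
Conjugate-empty conj e c = n≤0⇒n≡0 (≤-from-< λ r r< →
  ⊥-elim (n≮0 (subst (c <_) (e r) (proj₂ (conj r c) r<))))

Conjugate-rows : ∀ {lam lam* p} → Conjugate lam lam* → RowsAtMost p lam → FirstRowAtMost p lam*
Conjugate-rows conj atMost = ≤-from-< λ r r< → ≰⇒> λ p≤r →
  <⇒≢ (proj₂ (conj r 0) r<) (sym (atMost r p≤r))

Conjugate-columns : ∀ {lam lam* p} → Conjugate lam lam* → FirstRowAtMost p lam → RowsAtMost p lam*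
Conjugate-columns conj atMost c p≤c = n≤0⇒n≡0 (≮⇒≥ λ 0< →
  <⇒≱ (proj₂ (conj 0 c) 0<) (≤-trans atMost p≤c))

private
  -- The box added at the end of row `q` lies in column `lam q`, which had exactly `q` boxes before;
  -- all other columns keep their boxes.
  conjugate-up : ∀ {lam lam* μ μ*} q → Conjugate lam lam* → Conjugate μ μ* →
                 Moves (up q) lam μ → Moves (up (lam q)) lam* μ*
  conjugate-up {lam} {lam*} {μ} {μ*} q conj conj′ s c = case lam q ≟ c of λ where
      (no q≢c) → cong₂ _+_ (≤-antisym (≤-from-< λ r → proj₁ (conj′ r c) ∘ grows r ∘ proj₂ (conj r c))
                                      (≤-from-< λ r → proj₁ (conj r c) ∘ shrinks q≢c r ∘ proj₂ (conj′ r c)))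
                           (indicator-≢ q≢c)
      (yes refl) → trans (cong₂ _+_ lam*≡q (indicator-refl (lam q)))
                     (trans (+-comm q 1) (trans (sym μ*≡) (sym (+-identityʳ _))))
    where
    μ≡ : ∀ r → μ r ≡ lam r + indicator q r
    μ≡ r = trans (sym (+-identityʳ (μ r))) (sym (s r))
    grows : ∀ {c} r → c < lam r → c < μ r
    grows r c< = <-≤-trans c< (≤-trans (m≤m+n _ _) (≤-reflexive (sym (μ≡ r))))
    elsewhere : ∀ {r c} → q ≢ r → c < μ r → c < lam r
    elsewhere {r} {c} q≢r = subst (c <_) (trans (μ≡ r) (trans (cong (lam r +_) (indicator-≢ q≢r)) (+-identityʳ _)))
    μq≡ : μ q ≡ suc (lam q)
    μq≡ = trans (μ≡ q) (trans (cong (lam q +_) (indicator-refl q)) (+-comm (lam q) 1))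
    shrinks : ∀ {c} → lam q ≢ c → ∀ r → c < μ r → c < lam r
    shrinks {c} q≢c r c< with q ≟ r
    ... | no q≢r   = elsewhere q≢r c<
    ... | yes refl = ≤∧≢⇒< (≤-pred (subst (c <_) μq≡ c<)) (≢-sym q≢c)
    q<μ* : q < μ* (lam q)
    q<μ* = proj₁ (conj′ q (lam q)) (≤-reflexive (sym μq≡))
    lam*≡q : lam* (lam q) ≡ q
    lam*≡q = ≤-antisym (≮⇒≥ λ q< → <-irrefl refl (proj₂ (conj q (lam q)) q<))
      (≮⇒≥ λ lt → <-irrefl refl (proj₁ (conj _ (lam q))
        (elsewhere (>⇒≢ lt) (proj₂ (conj′ _ (lam q)) (<-trans lt q<μ*)))))
    μ*≡ : μ* (lam q) ≡ suc q
    μ*≡ = ≤-antisym (≮⇒≥ λ lt → <⇒≱ (proj₁ (conj (suc q) (lam q))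
        (elsewhere (≢-sym 1+n≢n) (proj₂ (conj′ (suc q) (lam q)) lt)))
          (≤-trans (≤-reflexive lam*≡q) (n≤1+n q)))
      q<μ*

Conjugate-moves : ∀ {lam lam* μ μ*} m → Conjugate lam lam* → Conjugate μ μ* →
                  Moves m lam μ → ∃[ m′ ] Moves m′ lam* μ*
Conjugate-moves {lam} (up q)   conj conj′ s = up (lam q) , conjugate-up q conj conj′ s
Conjugate-moves {lam} {lam*} {μ} {μ*} (down q) conj conj′ s = down (μ q) ,
  Moves-flip (up (μ q)) {μ*} {lam*} (conjugate-up q conj′ conj (λ k → sym (s k)))

-- `M` bounds the rows that are scanned. Stopping at the first row that is too short is right for
-- antitone shapes.
conjugate : ℕ → Shape → Shape
conjugate zero    lam c = 0
conjugate (suc M) lam c with c <? lam 0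
... | yes _ = suc (conjugate M (lam ∘ suc) c)
... | no _  = 0

conjugate-Conjugate : ∀ M {lam} → Antitone lam → RowsAtMost M lam → Conjugate lam (conjugate M lam)
conjugate-Conjugate zero    anti atMost r c = (λ c< → ⊥-elim (n≮0 (subst (c <_) (atMost r z≤n) c<))) , λ ()
conjugate-Conjugate (suc M) {lam} anti atMost r c with c <? lam 0
conjugate-Conjugate (suc M) {lam} anti atMost r c | no c≮ =
  (λ c< → ⊥-elim (c≮ (<-≤-trans c< (Antitone-≤ anti z≤n)))) , λ ()
conjugate-Conjugate (suc M) {lam} anti atMost zero c | yes c<0 = (λ _ → z<s) , λ _ → c<0
conjugate-Conjugate (suc M) {lam} anti atMost (suc r) c | yes _ = map (s≤s ∘_) (_∘ ≤-pred)
  (conjugate-Conjugate M {lam ∘ suc} (anti ∘ suc) (λ r M≤r → atMost (suc r) (s≤s M≤r)) r c)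

module Transpose {n : ℕ} {A B : Shape → Set} (M : ℕ) (osc : Oscillating n A)
                 (atMost : ∀ t → t ≤ n → RowsAtMost M (Oscillating.shape osc t))
                 (convert : ∀ {lam lam*} → Conjugate lam lam* → A lam → B lam*) where
  open Oscillating osc

  conjugates : ∀ t → t ≤ n → Conjugate (shape t) (conjugate M (shape t))
  conjugates t t≤n = conjugate-Conjugate M (antitone t t≤n) (atMost t t≤n)

  private
    moves* : ∀ t → t < n → ∃[ μ ] Moves μ (conjugate M (shape t)) (conjugate M (shape (suc t)))
    moves* t t<n = Conjugate-moves (move t) (conjugates t (<⇒≤ t<n)) (conjugates (suc t) t<n) (moves t t<n)

  transpose : Oscillating n B
  transpose = oscillatingFrom (λ t → conjugate M (shape t))
    (Conjugate-empty (conjugates 0 z≤n) starts)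
    (Conjugate-empty (conjugates n ≤-refl) ends)
    (λ t t≤n → Conjugate-antitone (conjugates t t≤n))
    moves*
    (λ t t≤n → convert (conjugates t t≤n) (allowed t t≤n))

transposition : ∀ N p →
  Bijection (oscillating (2 * N) (RowsAtMost p)) (oscillating (2 * N) (FirstRowAtMost p))
transposition N p = record
  { to        = T.transpose
  ; cong      = λ {o} {o′} e t t≤n → Conjugate-cong (T.conjugates o t t≤n) (T.conjugates o′ t t≤n) (e t t≤n)
  ; bijective = (λ {o} {o′} e t t≤n → Conjugate-cong
                  (Conjugate-sym (T.conjugates o t t≤n)) (Conjugate-sym (T.conjugates o′ t t≤n)) (e t t≤n)) ,
                λ o → T′.transpose o , λ {z} e t t≤n → Conjugate-cong
                  (T.conjugates z t t≤n) (Conjugate-sym (T′.conjugates o t t≤n)) (e t t≤n)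
  }
  where
  -- In one direction the number of rows is bounded by `p`; in the other only the length `2 * N` of
  -- the tableau bounds it, by `N`.
  module T (o : Oscillating (2 * N) (RowsAtMost p)) = Transpose p o (Oscillating.allowed o) Conjugate-rows
  module T′ (o : Oscillating (2 * N) (FirstRowAtMost p)) = Transpose N o (rows-bounded o) Conjugate-columns

-- Walkers of the second class

module _ (N p m : ℕ) (N≤m : N ≤ suc m) where
  private
    n = 2 * N

    -- The right-most walker belongs to row 0 and never gets left of its initial site, so the
    -- absolute value is the displacement itself.
    displacement-row : (walk : FirstClass N (suc m)) → ∀ t →
      ∣ displacement (FirstClass.configuration walk) t ∣ ≡ Walk.shape N (suc m) walk (toℕ t) 0
    displacement-row walk t = begin
      ∣ positions configuration t last ℤ.- initial configuration last ∣
        ≡⟨ cong₂ (λ a b → ∣ a ℤ.- b ∣) (located t last) (startsPacked last) ⟩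
      ∣ ℤ.+ suc (toℕ last + rowsAt t (rowOf last)) ℤ.- ℤ.+ suc (toℕ last) ∣
        ≡⟨ cong ∣_∣ (cancel (ℤ.+ suc (toℕ last)) (ℤ.+ rowsAt t (rowOf last))) ⟩
      rowsAt t (rowOf last)
        ≡⟨ cong (rowsAt t) last-row ⟩
      rowsAt t 0
        ≡⟨ shape-toℕ t 0 ⟨
      shape (toℕ t) 0 ∎
      where
      open ≡-Reasoning
      open FirstClass walk
      open Walk N (suc m) walk
      last : Fin (suc m)
      last = fromℕ m
      last-row : rowOf last ≡ 0
      last-row = +-cancelˡ-≡ m _ _ (trans (cong (_+ rowOf last) (sym (toℕ-fromℕ m)))
        (trans (suc-injective (rowOf-sum last)) (sym (+-identityʳ m))))
      cancel : ∀ i j → (i ℤ.+ j) ℤ.- i ≡ j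
      cancel i j = trans (cong (ℤ._- i) (ℤ.+-comm i j))
        (trans (ℤ.+-assoc j i (ℤ.- i)) (trans (cong (λ k → j ℤ.+ k) (ℤ.+-inverseʳ i)) (ℤ.+-identityʳ j)))

    module W = Bijection (walks⤖oscillations N (suc m))

    unbounded : SecondClass N p (suc m) → FirstClass N (suc m)
    unbounded walk = record { SecondClass walk }

    first-row : (walk : SecondClass N p (suc m)) → ∀ t → t ≤ n →
                FirstRowAtMost p (Oscillating.shape (W.to (unbounded walk)) t)
    first-row walk t t≤n = subst (λ u → Walk.shape N (suc m) (unbounded walk) u 0 ≤ p)
      (toℕ-fromℕ< (s≤s t≤n))
      (subst (_≤ p) (displacement-row (unbounded walk) (fromℕ< (s≤s t≤n)))
        (SecondClass.bounded walk (fromℕ< (s≤s t≤n))))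

  -- A tableau of length `2 * N` has at most `N` rows, so `suc m` walkers always suffice to carry
  -- them, and only the bound on the first row remains.
  boundedWalks⤖oscillations : Bijection (secondClass N p (suc m)) (oscillating n (FirstRowAtMost p))
  boundedWalks⤖oscillations = record
    { to        = λ walk → restrict (W.to (unbounded walk)) (first-row walk)
    ; cong      = λ {c} {c′} → W.cong {unbounded c} {unbounded c′}
    ; bijective = (λ {c} {c′} → W.injective {unbounded c} {unbounded c′}) , λ osc →
        let osc′ = restrict osc (λ t t≤n r m<r → rows-bounded osc t t≤n r (≤-trans N≤m m<r))
            walk , walk≈ = W.surjective osc′
        in record { FirstClass walk
                  ; bounded = λ t → subst (_≤ p) (sym (trans (displacement-row walk t)
                      (walk≈ {walk} (λ _ _ → refl) (toℕ t) (≤-pred (toℕ<n t)) 0)))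
                      (Oscillating.allowed osc (toℕ t) (≤-pred (toℕ<n t))) } ,
           λ {z} → walk≈ {unbounded z}
    }

proposition1 : (N p N* : ℕ) → (1≤N : 1 ≤ N) → 1 ≤ p → (N≤N* : N ≤ N*) →
    Bijection (firstClass N p) (boundedInvolutions N p) ×
    Bijection (secondClass N p N* {{>-nonZero (≤-trans 1≤N N≤N*)}}) (boundedInvolutions N p)
proposition1 N p zero     1≤N _ N≤N* = ⊥-elim (<⇒≱ 1≤N N≤N*)
proposition1 N p (suc N*) 1≤N _ N≤N* =
  -- The number `p` of walkers bounds the rows and calls for conjugation; the bound on the
  -- displacement is one on the first row already.
  bijection (bijection (walks⤖oscillations N p) (transposition N p)) (oscillations⤖involutions N p) ,
  bijection (boundedWalks⤖oscillations N p N* N≤N*) (oscillations⤖involutions N p)
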